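{- For every infinite ordinal $\alpha$, subclasses of ${}_\infty\mathsf{Lf}_\alpha$ generate continuum many ($2^\omega$) varieties. In other words, there are continuum many inductive varieties (of $\mathsf{CA}_\alpha$s) of infinite base.
   Context: A cylindric algebra of dimension $\alpha$ (a $\mathsf{CA}_\alpha$) is an algebra $\langle A,+,-,c_i,d_{ij}: i,j\in\alpha\rangle$ satisfying the cylindric axioms: $\langle A,+,-\rangle$ is a Boolean algebra and for all distinct $i,j,k\in\alpha$: $c_ic_jx=c_jc_ix$, $x\le c_ix=c_ic_ix$, $c_i(x+y)=c_ix+c_iy$, $c_i-c_ix=-c_ix$, $d_{ii}=1$, $d_{ij}=d_{ji}$, $c_j(d_{ij}\cdot d_{jk})=d_{ik}$, $c_id_{ij}=1$, $d_{ij}\cdot c_i(d_{ij}\cdot x)=d_{ij}\cdot x$. $\mathsf{Lf}_\alpha$ is the class of those $\mathsf{CA}_\alpha$s in which for each element $x$ we have $c_ix=x$ for all but finitely many $i\in\alpha$. For $m\in\omega$ let $a_m$ be the constant term $c_0c_1\cdots c_{m-1}\prod\{ -d_{ij}: i<j<m\}$. A cylindric algebra is of infinite base if the equations $a_m=1$ ($m\in\omega$) are valid in it. ${}_\infty\mathsf{Lf}_\alpha$ is the class of $\mathsf{Lf}_\alpha$s of infinite base. The variety generated by a class is the least variety (equationally definable class) containing it. Equations use a fixed countably infinite set of variables. A set $E$ of equations in the language of $\mathsf{CA}_\alpha$ is inductive if it contains the cylindric axioms, is semantically closed ($e\in E$ iff $E\models e$), and $e(c_ix_1,\dots,c_ix_n)\in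 E$ implies $e(x_1,\dots,x_n)\in E$ whenever $e$ is an equation (with variables $x_1,\dots,x_n$) and $i\in\alpha$ does not occur as an index of an operation in $e$ (i.e. neither $c_i$ nor any $d_{ij}$, $d_{ji}$ occurs in $e$). An inductive variety of infinite base is a variety whose equational theory is inductive and contains the equations $a_m=1$ for all $m\in\omega$. -}

module Defs where

open import Level using (Level; suc; _⊔_)
open import Data.Bool.Base using (Bool)
open import Data.List.Base using (List; []; _∷_; _++_; foldr; map; concatMap; upTo)
open import Data.List.Membership.Propositional using (_∈_; _∉_)
open import Data.Nat.Base as ℕ using (ℕ)
open import Data.Product.Base using (Σ-syntax; ∃-syntax; _×_; _,_; proj₁)
open import Function.Bundles using (Bijection; _⇔_)
open import Induction.WellFounded using (WellFounded)
open import Relation.Binary.Bundles using (Setoid)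
open import Relation.Binary.Core using (Rel)
open import Relation.Binary.PropositionalEquality using (_≡_; _≢_; _→-setoid_)
open import Relation.Binary.Structures using (IsEquivalence; IsStrictTotalOrder)
open import Relation.Unary using (Pred; _⊆_; _≐_; _∩_)
open import Relation.Unary.Relation.Binary.Equality using (≐-setoid)
open import Algebra.Lattice.Structures using (IsBooleanAlgebra)
import Relation.Binary.Construct.On as On

-- An ordinal is a well-ordered type.  It is infinite iff ω ≤ α, that is, iff
-- ω is order isomorphic to an initial segment of it; the embedding `fin` is
-- then unique, and `fin n` is the index written n in c₀, c₁, d₀₁, ….
record InfiniteOrdinal (ℓ : Level) : Set (suc ℓ) where
  infix 4 _<_
  field
    Index              : Set ℓ
    _<_                : Rel Index ℓ
    isStrictTotalOrder : IsStrictTotalOrder _≡_ _<_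
    wellFounded        : WellFounded _<_
    fin                : ℕ → Index
    fin-mono           : ∀ {m n} → m ℕ.< n → fin m < fin n
    fin-initial        : ∀ {i n} → i < fin n → ∃[ m ] i ≡ fin m

module _ {ℓ : Level} (α : InfiniteOrdinal ℓ) where
  open InfiniteOrdinal α using (Index)

  infixl 6 _+_
  infix  8 -_

  data Term : Set ℓ where
    var : ℕ → Term
    _+_ : Term → Term → Term
    -_  : Term → Term
    c   : Index → Term → Term
    d   : Index → Index → Term

  infix 4 _≈ₑ_

  record Equation : Set ℓ where
    constructor _≈ₑ_
    field
      lhs rhs : Term

  -- Algebras of the similarity type of CA_α; equality is a congruence _≈_.
  record Algebra : Set (suc ℓ) where
    infix  4 _≈_
    infixl 6 _⊕_
    infix  8 ⊖_
    field
      Carrier       : Set ℓ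
      _≈_           : Rel Carrier ℓ
      isEquivalence : IsEquivalence _≈_
      _⊕_           : Carrier → Carrier → Carrier
      ⊖_            : Carrier → Carrier
      cyl           : Index → Carrier → Carrier
      diag          : Index → Index → Carrier
      ⊕-cong        : ∀ {x x′ y y′} → x ≈ x′ → y ≈ y′ → x ⊕ y ≈ x′ ⊕ y′
      ⊖-cong        : ∀ {x x′} → x ≈ x′ → ⊖ x ≈ ⊖ x′
      cyl-cong      : ∀ i {x x′} → x ≈ x′ → cyl i x ≈ cyl i x′

module _ {ℓ : Level} {α : InfiniteOrdinal ℓ} where
  open InfiniteOrdinal α using (Index; fin)

  infixl 7 _·_

  _·_ : Term α → Term α → Term α
  s · t = - (- s + - t)

  -- The signature has no constant for the unit.  Any diagonal would do here
  -- in place of d₀₀; this choice makes 𝟏 a closed term.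
  𝟏 𝟎 : Term α
  𝟏 = d (fin 0) (fin 0) + - d (fin 0) (fin 0)
  𝟎 = - 𝟏

  module _ (A : Algebra α) where
    open Algebra A

    ⟦_⟧ : Term α → (ℕ → Carrier) → Carrier
    ⟦ var v ⟧ ρ = ρ v
    ⟦ s + t ⟧ ρ = ⟦ s ⟧ ρ ⊕ ⟦ t ⟧ ρ
    ⟦ - t   ⟧ ρ = ⊖ ⟦ t ⟧ ρ
    ⟦ c i t ⟧ ρ = cyl i (⟦ t ⟧ ρ)
    ⟦ d i j ⟧ ρ = diag i j

  infix 4 _⊨_ _⊫_

  _⊨_ : Algebra α → Equation α → Set ℓ
  A ⊨ (s ≈ₑ t) = ∀ ρ → Algebra._≈_ A (⟦_⟧ A s ρ) (⟦_⟧ A t ρ)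

  Class Theory : Set (suc (suc ℓ))
  Class  = Pred (Algebra α) (suc ℓ)
  Theory = Pred (Equation α) (suc ℓ)

  Mod : Theory → Class
  Mod E A = ∀ {e} → E e → A ⊨ e

  Th : Class → Theory
  Th K e = ∀ {A} → K A → A ⊨ e

  _⊫_ : Theory → Equation α → Set (suc ℓ)
  E ⊫ e = Th (Mod E) e

  private
    x y z : Term α
    x = var 0
    y = var 1
    z = var 2

  data BooleanAxiom : Equation α → Set (suc ℓ) where
    +-comm         : BooleanAxiom (x + y ≈ₑ y + x)
    +-assoc        : BooleanAxiom ((x + y) + z ≈ₑ x + (y + z))
    ·-comm         : BooleanAxiom (x · y ≈ₑ y · x)
    ·-assoc        : BooleanAxiom ((x · y) · z ≈ₑ x · (y · z))
    +-absorbs-·    : BooleanAxiom (x + x · y ≈ₑ x)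
    ·-absorbs-+    : BooleanAxiom (x · (x + y) ≈ₑ x)
    +-distribˡ-·   : BooleanAxiom (x + y · z ≈ₑ (x + y) · (x + z))
    +-distribʳ-·   : BooleanAxiom (y · z + x ≈ₑ (y + x) · (z + x))
    ·-distribˡ-+   : BooleanAxiom (x · (y + z) ≈ₑ x · y + x · z)
    ·-distribʳ-+   : BooleanAxiom ((y + z) · x ≈ₑ y · x + z · x)
    +-complementˡ  : BooleanAxiom (- x + x ≈ₑ 𝟏)
    +-complementʳ  : BooleanAxiom (x + - x ≈ₑ 𝟏)
    ·-complementˡ  : BooleanAxiom (- x · x ≈ₑ 𝟎)
    ·-complementʳ  : BooleanAxiom (x · - x ≈ₑ 𝟎)

  -- s ≤ t abbreviates s + t = t.
  data CylindricAxiom : Equation α → Set (suc ℓ) where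
    boolean  : ∀ {e} → BooleanAxiom e → CylindricAxiom e
    c-comm   : ∀ {i j} → i ≢ j → CylindricAxiom (c i (c j x) ≈ₑ c j (c i x))
    c-incr   : ∀ {i} → CylindricAxiom (x + c i x ≈ₑ c i x)
    c-idem   : ∀ {i} → CylindricAxiom (c i x ≈ₑ c i (c i x))
    c-+      : ∀ {i} → CylindricAxiom (c i (x + y) ≈ₑ c i x + c i y)
    c-compl  : ∀ {i} → CylindricAxiom (c i (- c i x) ≈ₑ - c i x)
    d-refl   : ∀ {i} → CylindricAxiom (d i i ≈ₑ 𝟏)
    d-sym    : ∀ {i j} → i ≢ j → CylindricAxiom (d i j ≈ₑ d j i)
    d-trans  : ∀ {i j k} → i ≢ j → i ≢ k → j ≢ k →
               CylindricAxiom (c j (d i j · d j k) ≈ₑ d i k)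
    c-d      : ∀ {i j} → i ≢ j → CylindricAxiom (c i (d i j) ≈ₑ 𝟏)
    d-c      : ∀ {i j} → i ≢ j →
               CylindricAxiom (d i j · c i (d i j · x) ≈ₑ d i j · x)

  CA : Class
  CA = Mod CylindricAxiom

  -- The Boolean axioms say exactly that ⟨A,+,-⟩ is a Boolean algebra in the
  -- library's sense, with the derived meet, unit and zero.
  module _ (A : Algebra α) where
    open Algebra A
    open IsEquivalence isEquivalence using (refl; sym; trans)

    _⊙_ : Carrier → Carrier → Carrier
    a ⊙ b = ⊖ (⊖ a ⊕ ⊖ b)

    unit zero : Carrier
    unit = diag (fin 0) (fin 0) ⊕ ⊖ diag (fin 0) (fin 0)
    zero = ⊖ unit

    IsBoolean : Set ℓ
    IsBoolean = IsBooleanAlgebra _≈_ _⊕_ _⊙_ ⊖_ unit zero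

    private
      val : Carrier → Carrier → Carrier → ℕ → Carrier
      val p q r 0 = p
      val p q r 1 = q
      val p q r _ = r

    boolean⇒isBooleanAlgebra : Mod BooleanAxiom A → IsBoolean
    boolean⇒isBooleanAlgebra ax = record
      { isDistributiveLattice = record
        { isLattice = record
          { isEquivalence = isEquivalence
          ; ∨-comm  = λ p q → ax +-comm (val p q q)
          ; ∨-assoc = λ p q r → ax +-assoc (val p q r)
          ; ∨-cong  = ⊕-cong
          ; ∧-comm  = λ p q → ax ·-comm (val p q q)
          ; ∧-assoc = λ p q r → ax ·-assoc (val p q r)
          ; ∧-cong  = λ p q → ⊖-cong (⊕-cong (⊖-cong p) (⊖-cong q))
          ; absorptive = (λ p q → ax +-absorbs-· (val p q q))
                       , (λ p q → ax ·-absorbs-+ (val p q q))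
          }
        ; ∨-distrib-∧ = (λ p q r → ax +-distribˡ-· (val p q r))
                      , (λ p q r → ax +-distribʳ-· (val p q r))
        ; ∧-distrib-∨ = (λ p q r → ax ·-distribˡ-+ (val p q r))
                      , (λ p q r → ax ·-distribʳ-+ (val p q r))
        }
      ; ∨-complement = (λ a → ax +-complementˡ (val a a a))
                     , (λ a → ax +-complementʳ (val a a a))
      ; ∧-complement = (λ a → ax ·-complementˡ (val a a a))
                     , (λ a → ax ·-complementʳ (val a a a))
      ; ¬-cong = ⊖-cong
      }

    isBooleanAlgebra⇒boolean : IsBoolean → Mod BooleanAxiom A
    isBooleanAlgebra⇒boolean isBA = go
      where
      open IsBooleanAlgebra isBA
      go : Mod BooleanAxiom A
      go +-comm ρ        = ∨-comm _ _
      go +-assoc ρ       = ∨-assoc _ _ _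
      go ·-comm ρ        = ∧-comm _ _
      go ·-assoc ρ       = ∧-assoc _ _ _
      go +-absorbs-· ρ   = ∨-absorbs-∧ _ _
      go ·-absorbs-+ ρ   = ∧-absorbs-∨ _ _
      go +-distribˡ-· ρ  = ∨-distribˡ-∧ _ _ _
      go +-distribʳ-· ρ  = ∨-distribʳ-∧ _ _ _
      go ·-distribˡ-+ ρ  = ∧-distribˡ-∨ _ _ _
      go ·-distribʳ-+ ρ  = ∧-distribʳ-∨ _ _ _
      go +-complementˡ ρ = ∨-complementˡ _
      go +-complementʳ ρ = ∨-complementʳ _
      go ·-complementˡ ρ = ∧-complementˡ _
      go ·-complementʳ ρ = ∧-complementʳ _

  LocallyFinite : Pred (Algebra α) ℓ
  LocallyFinite A = ∀ a → ∃[ Γ ] (∀ i → i ∉ Γ → cyl i a ≈ a)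
    where open Algebra A

  ∏ : List (Term α) → Term α
  ∏ = foldr _·_ 𝟏

  -- c₀ c₁ ⋯ c₍ₘ₋₁₎ ∏ { - d_ij : i < j < m }
  a[_] : ℕ → Term α
  a[ m ] = foldr (λ k → c (fin k))
             (∏ (concatMap (λ j → map (λ i → - d (fin i) (fin j)) (upTo j)) (upTo m)))
             (upTo m)

  InfiniteBase : Pred (Algebra α) ℓ
  InfiniteBase A = ∀ m → A ⊨ (a[ m ] ≈ₑ 𝟏)

  ∞Lf : Class
  ∞Lf = CA ∩ LocallyFinite ∩ InfiniteBase

  IsVariety : Class → Set (suc (suc ℓ))
  IsVariety V = ∃[ E ] V ≐ Mod E

  record _IsGeneratedBy_ (V K : Class) : Set (suc (suc ℓ)) where
    field
      isVariety : IsVariety V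
      contains  : K ⊆ V
      least     : ∀ W → IsVariety W → K ⊆ W → V ⊆ W

  indices : Term α → List Index
  indices (var v) = []
  indices (s + t) = indices s ++ indices t
  indices (- t)   = indices t
  indices (c i t) = i ∷ indices t
  indices (d i j) = i ∷ j ∷ []

  indicesₑ : Equation α → List Index
  indicesₑ (s ≈ₑ t) = indices s ++ indices t

  infix 9 _[_]

  _[_] : Term α → (ℕ → Term α) → Term α
  var v   [ σ ] = σ v
  (s + t) [ σ ] = s [ σ ] + t [ σ ]
  (- t)   [ σ ] = - (t [ σ ])
  c i t   [ σ ] = c i (t [ σ ])
  d i j   [ σ ] = d i j

  -- e(x₁,…,xₙ) ↦ e(c_i x₁,…,c_i xₙ), where x₁,…,xₙ are all the variables of e.
  cylVars : Index → Equation α → Equation α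
  cylVars i (s ≈ₑ t) = s [ (λ v → c i (var v)) ] ≈ₑ t [ (λ v → c i (var v)) ]

  record Inductive (E : Theory) : Set (suc ℓ) where
    field
      cylindric : CylindricAxiom ⊆ E
      closed    : ∀ e → E e ⇔ E ⊫ e
      descent   : ∀ e i → i ∉ indicesₑ e → E (cylVars i e) → E e

  IsInductiveOfInfiniteBase : Pred Class (suc (suc ℓ))
  IsInductiveOfInfiniteBase V =
    IsVariety V × Inductive (Th V) × (∀ m → Th V (a[ m ] ≈ₑ 𝟏))

-- Collections of varieties are setoids: two varieties are identified when
-- they have the same members, whatever witnesses of membership in the
-- collection they come with.
Varieties : ∀ {ℓ} (α : InfiniteOrdinal ℓ) →
            Pred (Class {α = α}) (suc (suc ℓ)) → Setoid (suc (suc ℓ)) (suc ℓ)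
Varieties {ℓ} α P = On.setoid {B = Σ[ V ∈ Class {α = α} ] P V}
                      (≐-setoid (Algebra α) (suc ℓ)) proj₁

LfGeneratedVarieties : ∀ {ℓ} → InfiniteOrdinal ℓ → Setoid (suc (suc ℓ)) (suc ℓ)
LfGeneratedVarieties α =
  Varieties α (λ V → ∃[ K ] (K ⊆ ∞Lf {α = α} × V IsGeneratedBy K))

InductiveVarietiesOfInfiniteBase : ∀ {ℓ} → InfiniteOrdinal ℓ →
                                   Setoid (suc (suc ℓ)) (suc ℓ)
InductiveVarietiesOfInfiniteBase α = Varieties α IsInductiveOfInfiniteBase

ContinuumMany : ∀ {a ℓ} → Setoid a ℓ → Set (a ⊔ ℓ)
ContinuumMany S = Bijection S (ℕ →-setoid Bool)

{-# OPTIONS --safe #-}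

-- Upper bound.  In a CA, substituting a new index j for i is an isomorphism
-- between the elements closed under c_j and those closed under c_i, and it
-- turns every term into the renamed term.  Hence an inductive theory is
-- invariant under renaming i to a new j, so it is determined by its equations
-- over the indices 0, 1, 2, …, of which there are countably many.  The same
-- substitution shows that theories of subclasses of Lf are inductive.
--
-- Lower bound.  For q > 1 let A_q consist of the finitary relations on a set of
-- infinitely many q-cycles that are invariant under rotating each cycle
-- separately.  In A_q the equation "no serial irreflexive binary relation has
-- its p-th power contained in the identity" fails for p = q, because of the
-- successor relation, and holds whenever p and q are coprime.  Pairwise coprime
-- moduli thus give continuum many varieties.
--
-- The two bounds are combined by the Schröder–Bernstein theorem.
module Submission where

open import Defs
open import Axiom.ExcludedMiddle using (ExcludedMiddle)
open import Level as Level using (Level)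
open import Algebra.Lattice.Bundles using (BooleanAlgebra)
import Algebra.Lattice.Properties.BooleanAlgebra as BooleanAlgebraProperties
open import Data.Bool.Base using (Bool; true; false; T; not) renaming (_∨_ to _∨ᵇ_; _∧_ to _∧ᵇ_)
open import Data.Bool.Properties using (T-∧; T-∨; ⇔→≡) renaming (_≟_ to _≟ᵇ_)
open import Data.Empty using (⊥-elim)
open import Data.Product.Base using (_×_; _,_; proj₁; proj₂; ∃-syntax)
open import Data.List.Base using (List; []; _∷_; _++_; map; concatMap; foldr; upTo)
open import Data.List.Properties using (map-++)
open import Data.List.Membership.Propositional using (_∈_; _∉_)
open import Data.List.Membership.Propositional.Properties
  using (∈-++⁺ˡ; ∈-++⁺ʳ; ∈-map⁻; ∈-map⁺; ∈-concatMap⁺; ∈-upTo⁺; ∈-upTo⁻)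
open import Data.List.Relation.Unary.All using (All; []; _∷_)
import Data.List.Relation.Unary.All as All
open import Data.List.Relation.Unary.All.Properties using (concat⁺; map⁺)
open import Data.List.Relation.Unary.Any using (here; there)
import Data.List.Relation.Unary.Any as Any
open import Data.Nat.Base as ℕ using (ℕ; zero; suc; z≤n; s≤s; _⊔_; _≤_)
import Data.Nat.Properties as ℕ
open import Data.Nat.Coprimality using (Coprime; coprime-divisor)
import Data.Nat.Coprimality as Coprimality
open import Data.Nat.Divisibility
  using (_∣_; ∣-trans; m∣m*n; n∣m*n; ∣m+n∣m⇒∣n; ∣1⇒≡1; m%n≡0⇒n∣m; n∣m⇒m%n≡0)
open import Data.Nat.DivMod using (_%_; %-distribˡ-+; [m+kn]%n≡m%n; m<n⇒m%n≡m)
open import Data.Sum.Base using (_⊎_; inj₁; inj₂)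
open import Function.Base using (_∘_; case_of_)
open import Function.Construct.Composition using (injection)
open import Function.Bundles using (_⇔_; mk⇔; Equivalence; Injection; Bijection)
open import Relation.Nullary using (¬_; Dec; yes; no; contradiction)
open import Relation.Nullary.Decidable using (isYes; toWitness; fromWitness)
open import Relation.Unary using (_⊆_)
open import Relation.Binary.PropositionalEquality as ≡ using (_≡_; _≢_; _→-setoid_)
open import Relation.Binary.Structures using (IsStrictTotalOrder; IsEquivalence)
open import Relation.Binary.Bundles using (Setoid)
open import Relation.Binary.Definitions using (tri<; tri≈; tri>)
import Relation.Binary.Reasoning.Setoid as SetoidReasoning

-- What separates the algebras is which fixed-point-free permutations of finite order they contain
-- as relations. The obstacle is that a binary relation read off from an element has parameters: the
-- remaining coordinates of the valuation may name points and so break the symmetry. Only finitely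
-- many of them matter, so among infinitely many cycles one contains no parameter, and since the
-- cycles turn independently this one keeps its full rotation group. The infinitude of the cycles
-- also yields the infinite base. For the upper bound the language may be uncountable. Substitution
-- can be undone only on elements closed under the new index, whereas an equation speaks of all
-- elements; the descent condition of inductive theories closes exactly this gap, and in locally
-- finite algebras a sufficiently fresh index does.

-- Truth values, decisions and truth tables.

T-ext : ∀ {a b} → (T a → T b) → (T b → T a) → a ≡ b
T-ext {true}  {true}  _ _ = ≡.refl
T-ext {true}  {false} f _ = ⊥-elim (f _)
T-ext {false} {true}  _ g = ⊥-elim (g _)
T-ext {false} {false} _ _ = ≡.refl

T-not⁺ : ∀ {a} → ¬ T a → T (not a)
T-not⁺ {true}  ¬a = ⊥-elim (¬a _)
T-not⁺ {false} _  = _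

T-not⁻ : ∀ {a} → T (not a) → ¬ T a
T-not⁻ {false} _ ()

T-stable : ∀ {a} → ¬ T (not a) → T a
T-stable {true}  _  = _
T-stable {false} ¬a = ⊥-elim (¬a _)

-- Meets are derived operations of the signature, so they evaluate to this de Morgan form.
T-meet⁺ : ∀ {a b} → T a → T b → T (not (not a ∨ᵇ not b))
T-meet⁺ {true} {true} _ _ = _

T-meet⁻ : ∀ {a b} → T (not (not a ∨ᵇ not b)) → T a × T b
T-meet⁻ {true} {true} _ = _ , _

T-join⁺ : ∀ {a b} → T a ⊎ T b → T (a ∨ᵇ b)
T-join⁺ = Equivalence.from T-∨

T-join⁻ : ∀ {a b} → T (a ∨ᵇ b) → T a ⊎ T b
T-join⁻ = Equivalence.to T-∨

isYes-⇔ : ∀ {a b} {P : Set a} {Q : Set b} (P? : Dec P) (Q? : Dec Q) →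
          P ⇔ Q → isYes P? ≡ isYes Q?
isYes-⇔ (yes p) (yes q) P⇔Q = ≡.refl
isYes-⇔ (yes p) (no ¬q) P⇔Q = contradiction (Equivalence.to P⇔Q p) ¬q
isYes-⇔ (no ¬p) (yes q) P⇔Q = contradiction (Equivalence.from P⇔Q q) ¬p
isYes-⇔ (no ¬p) (no ¬q) P⇔Q = ≡.refl

isYes-transfer : ∀ {a b} {P : Set a} {Q : Set b} (P? : Dec P) (Q? : Dec Q) →
                 isYes P? ≡ isYes Q? → P → Q
isYes-transfer _       (yes q) _  _ = q
isYes-transfer (no ¬p) (no _)  _  p = contradiction p ¬p

everywhere : (Bool → Bool) → Bool
everywhere h = h true ∧ᵇ h false

everywhere⁻ : ∀ h → T (everywhere h) → ∀ x → T (h x)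
everywhere⁻ h p true  = proj₁ (Equivalence.to T-∧ p)
everywhere⁻ h p false = proj₂ (Equivalence.to (T-∧ {h true}) p)

agree₃ : (f g : Bool → Bool → Bool → Bool) → Bool
agree₃ f g = everywhere λ x → everywhere λ y → everywhere λ z → isYes (f x y z ≟ᵇ g x y z)

-- A decision by truth table: for concrete `f` and `g` the implicit argument computes to the unit
-- type and is filled in automatically.
tautology₃ : (f g : Bool → Bool → Bool → Bool) {_ : T (agree₃ f g)} →
             ∀ x y z → f x y z ≡ g x y z
tautology₃ f g {p} x y z = toWitness (everywhere⁻ (same x y)
  (everywhere⁻ (λ y → everywhere (same x y))
    (everywhere⁻ (λ x → everywhere λ y → everywhere (same x y)) p x) y) z)
  where
  same : Bool → Bool → Bool → Bool
  same x y z = isYes (f x y z ≟ᵇ g x y z)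

-- A set of points up to _~_.  The relations of its set algebra are required to
-- be invariant under the symmetries.
record Base : Set₁ where
  infix 4 _~_
  field
    Point            : Set
    _~_              : Point → Point → Set
    ~-isEquivalence  : IsEquivalence _~_
    Symmetry         : Set
    act              : Symmetry → Point → Point
    act-cong         : ∀ g {a b} → a ~ b → act g a ~ act g b
    act-reflects     : ∀ g {a b} → act g a ~ act g b → a ~ b
    act-surjective   : ∀ g b → ∃[ a ] act g a ~ b
    point            : ℕ → Point
    point-injective  : ∀ {m n} → point m ~ point n → m ≡ n
  open IsEquivalence ~-isEquivalence public
    renaming (refl to ~-refl; sym to ~-sym; trans to ~-trans; reflexive to ~-reflexive)

-- The Schröder-Bernstein theorem for setoids.

module SchröderBernstein (em : ∀ {a : Level} → ExcludedMiddle a)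
  {a ℓ₁ b ℓ₂ : Level} {S : Setoid a ℓ₁} {T : Setoid b ℓ₂}
  (f : Injection S T) (g : Injection T S) where

  private
    module S = Setoid S
    module T = Setoid T
    module f = Injection f
    module g = Injection g

  Image : S.Carrier → Set (b Level.⊔ ℓ₁)
  Image x = ∃[ y ] g.to y S.≈ x

  -- The iterated g ∘ f-images of the points outside the image of g.
  data Chain (x : S.Carrier) : Set (a Level.⊔ b Level.⊔ ℓ₁) where
    start : ¬ Image x → Chain x
    next  : ∀ {x₀} → Chain x₀ → g.to (f.to x₀) S.≈ x → Chain x

  chain-resp : ∀ {x y} → x S.≈ y → Chain x → Chain y
  chain-resp x≈y (start ¬im)  = start (λ (z , gz≈y) → ¬im (z , S.trans gz≈y (S.sym x≈y)))
  chain-resp x≈y (next ch eq) = next ch (S.trans eq x≈y)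

  preimage : ∀ {x} → ¬ Chain x → Image x
  preimage {x} ¬ch with em {P = Image x}
  ... | yes im = im
  ... | no ¬im = contradiction (start ¬im) ¬ch

  -- The decision is an argument so that the lemmas below can split on it; it is set to `em` only in
  -- `bijection`.
  value : ∀ x → Dec (Chain x) → T.Carrier
  value x (yes _)  = f.to x
  value x (no ¬ch) = proj₁ (preimage ¬ch)

  value-cong : ∀ {x y} (x? : Dec (Chain x)) (y? : Dec (Chain y)) → x S.≈ y → value x x? T.≈ value y y?
  value-cong (yes _)  (yes _)   x≈y = f.cong x≈y
  value-cong (yes ch) (no ¬ch)  x≈y = contradiction (chain-resp x≈y ch) ¬ch
  value-cong (no ¬ch) (yes ch)  x≈y = contradiction (chain-resp (S.sym x≈y) ch) ¬ch
  value-cong (no ¬ch) (no ¬ch′) x≈y = g.injective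
    (S.trans (proj₂ (preimage ¬ch)) (S.trans x≈y (S.sym (proj₂ (preimage ¬ch′)))))

  -- Equal values would make `y` the `g ∘ f`-image of `x`, which continues the chain of `x` to `y`.
  value-mixed : ∀ {x y} → Chain x → (¬ch : ¬ Chain y) → ¬ (f.to x T.≈ proj₁ (preimage ¬ch))
  value-mixed ch ¬ch eq = ¬ch (next ch (S.trans (g.cong eq) (proj₂ (preimage ¬ch))))

  value-injective : ∀ {x y} (x? : Dec (Chain x)) (y? : Dec (Chain y)) → value x x? T.≈ value y y? → x S.≈ y
  value-injective (yes _)  (yes _)   eq = f.injective eq
  value-injective (yes ch) (no ¬ch)  eq = contradiction eq (value-mixed ch ¬ch)
  value-injective (no ¬ch) (yes ch)  eq = contradiction (T.sym eq) (value-mixed ch ¬ch)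
  value-injective (no ¬ch) (no ¬ch′) eq =
    S.trans (S.sym (proj₂ (preimage ¬ch))) (S.trans (g.cong eq) (proj₂ (preimage ¬ch′)))

  -- If `g.to y` lies on a chain, it cannot be its start, and the preceding point of the chain is
  -- mapped to `y`; otherwise `g.to y` itself is.
  value-surjective : ∀ y → ∃[ x ] (∀ (x? : Dec (Chain x)) → value x x? T.≈ y)
  value-surjective y with em {P = Chain (g.to y)}
  ... | yes (start ¬im) = contradiction (y , S.refl) ¬im
  ... | yes (next {x} ch eq) = x , λ where
    (yes _)  → g.injective eq
    (no ¬ch) → contradiction ch ¬ch
  ... | no ¬ch = g.to y , λ where
    (yes ch)  → contradiction ch ¬ch
    (no ¬ch′) → g.injective (proj₂ (preimage ¬ch′))

  bijection : Bijection S T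
  bijection = record
    { to        = λ x → value x em
    ; cong      = value-cong em em
    ; bijective = value-injective em em , λ y →
        let (x , val) = value-surjective y in
        x , λ z≈x → T.trans (value-cong em em z≈x) (val em)
    }

-- Residues and disjoint unions of cycles.

%-cong-+ʳ : ∀ m n q .{{_ : ℕ.NonZero q}} k → m % q ≡ n % q → (m ℕ.+ k) % q ≡ (n ℕ.+ k) % q
%-cong-+ʳ m n q k eq = ≡.trans (%-distribˡ-+ m k q)
  (≡.trans (≡.cong (λ r → (r ℕ.+ k % q) % q) eq) (≡.sym (%-distribˡ-+ n k q)))

-- Modulo `suc q` the number `k ℕ.* q` acts as the negative of `k`: their sum is the multiple
-- `k ℕ.* suc q`. This gives cancellation and inverse rotations without subtraction.
+-complement-% : ∀ m k q → (m ℕ.+ k ℕ.+ k ℕ.* q) % suc q ≡ m % suc q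
+-complement-% m k q = ≡.trans
  (≡.cong (_% suc q) (≡.trans (ℕ.+-assoc m k (k ℕ.* q)) (≡.cong (m ℕ.+_) (≡.sym (ℕ.*-suc k q)))))
  ([m+kn]%n≡m%n m k (suc q))

%-cancel-+ʳ : ∀ m n q k → (m ℕ.+ k) % suc q ≡ (n ℕ.+ k) % suc q → m % suc q ≡ n % suc q
%-cancel-+ʳ m n q k eq = ≡.trans (≡.sym (+-complement-% m k q))
  (≡.trans (%-cong-+ʳ (m ℕ.+ k) (n ℕ.+ k) (suc q) (k ℕ.* q) eq) (+-complement-% n k q))

record SamePosition (q : ℕ) .{{_ : ℕ.NonZero q}} (x y : ℕ × ℕ) : Set where
  constructor _,_
  field
    cycle    : proj₁ x ≡ proj₁ y
    position : proj₂ x % q ≡ proj₂ y % q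

open SamePosition

-- ℕ many cycles of length 1 + q: (b , v) is position v modulo 1 + q on cycle b.
-- The symmetries rotate the cycles independently of each other.
cyclic : ℕ → Base
cyclic q = record
  { Point           = ℕ × ℕ
  ; _~_             = SamePosition (suc q)
  ; ~-isEquivalence = record
    { refl  = ≡.refl , ≡.refl
    ; sym   = λ (p , r) → ≡.sym p , ≡.sym r
    ; trans = λ (p , r) (p′ , r′) → ≡.trans p p′ , ≡.trans r r′
    }
  ; Symmetry        = ℕ → ℕ
  ; act             = λ g (b , v) → b , v ℕ.+ g b
  ; act-cong        = λ { g {b , v} {_ , v′} (≡.refl , r) → ≡.refl , %-cong-+ʳ v v′ (suc q) (g b) r }
  ; act-reflects    = λ { g {b , v} {_ , v′} (≡.refl , r) → ≡.refl , %-cancel-+ʳ v v′ q (g b) r }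
  -- Rotating by `g b ℕ.* q` undoes rotating by `g b`.
  ; act-surjective  = λ g (b , v) → (b , v ℕ.+ g b ℕ.* q) , ≡.refl ,
      ≡.trans (≡.cong (_% suc q) (shuffle v (g b))) (+-complement-% v (g b) q)
  ; point           = λ n → n , 0
  ; point-injective = cycle
  }
  where
  shuffle : ∀ v k → v ℕ.+ k ℕ.* q ℕ.+ k ≡ v ℕ.+ k ℕ.+ k ℕ.* q
  shuffle v k = ≡.trans (ℕ.+-assoc v _ k)
    (≡.trans (≡.cong (v ℕ.+_) (ℕ.+-comm _ k)) (≡.sym (ℕ.+-assoc v k _)))

-- Pairwise coprime moduli.

-- The Sylvester sequence 2, 3, 7, 43, ….
sylvesterProduct sylvester : ℕ → ℕ
sylvesterProduct 0       = 1
sylvesterProduct (suc n) = sylvesterProduct n ℕ.* sylvester n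
sylvester n = suc (sylvesterProduct n)

sylvester-∣ : ∀ {m n} → m ℕ.< n → sylvester m ∣ sylvesterProduct n
sylvester-∣ {m} {suc n} (s≤s m≤n) with ℕ.m≤n⇒m<n∨m≡n m≤n
... | inj₁ m<n    = ∣-trans (sylvester-∣ m<n) (m∣m*n (sylvester n))
... | inj₂ ≡.refl = n∣m*n (sylvesterProduct n)

-- Euclid's argument: `sylvester m` is a factor of `sylvesterProduct n`, so a common divisor divides
-- both this product and its successor, hence 1.
sylvester-coprime-< : ∀ {m n} → m ℕ.< n → Coprime (sylvester m) (sylvester n)
sylvester-coprime-< {m} {n} m<n {k} (k∣m , k∣n) = ∣1⇒≡1
  (∣m+n∣m⇒∣n {m = sylvesterProduct n} (≡.subst (k ∣_) (ℕ.+-comm 1 (sylvesterProduct n)) k∣n) (∣-trans k∣m (sylvester-∣ m<n)))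

sylvester-coprime : ∀ {m n} → m ≢ n → Coprime (sylvester m) (sylvester n)
sylvester-coprime {m} {n} m≢n with ℕ.<-cmp m n
... | tri< m<n _ _ = sylvester-coprime-< m<n
... | tri≈ _ m≡n _ = contradiction m≡n m≢n
... | tri> _ _ n<m = Coprimality.sym (sylvester-coprime-< n<m)

1<sylvester : ∀ n → 1 ℕ.< sylvester n
1<sylvester n = s≤s (positive n)
  where
  positive : ∀ n → 1 ≤ sylvesterProduct n
  positive 0       = ℕ.≤-refl
  positive (suc n) = ℕ.*-mono-≤ (positive n) (s≤s z≤n)

module _ {ℓ : Level} {α : InfiniteOrdinal ℓ} where
  open InfiniteOrdinal α using (Index; fin; fin-mono)
  open IsStrictTotalOrder (InfiniteOrdinal.isStrictTotalOrder α) using (_≟_; irrefl)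

  -- Renaming of indices in terms.

  replace : Index → Index → Index → Index
  replace i j k with k ≟ i
  ... | yes _ = j
  ... | no  _ = k

  replace-same : ∀ {i j} → replace i j i ≡ j
  replace-same {i} with i ≟ i
  ... | yes _   = ≡.refl
  ... | no  i≢i = contradiction ≡.refl i≢i

  replace-other : ∀ {i j k} → k ≢ i → replace i j k ≡ k
  replace-other {i} {j} {k} k≢i with k ≟ i
  ... | yes k≡i = contradiction k≡i k≢i
  ... | no  _   = ≡.refl

  rename : Index → Index → Term α → Term α
  rename i j (var v) = var v
  rename i j (s + t) = rename i j s + rename i j t
  rename i j (- t)   = - rename i j t
  rename i j (c k t) = c (replace i j k) (rename i j t)
  rename i j (d k l) = d (replace i j k) (replace i j l)

  renameₑ : Index → Index → Equation α → Equation α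
  renameₑ i j (s ≈ₑ t) = rename i j s ≈ₑ rename i j t

  variables : Term α → List ℕ
  variables (var v) = v ∷ []
  variables (s + t) = variables s ++ variables t
  variables (- t)   = variables t
  variables (c i t) = variables t
  variables (d i j) = []

  -- Derived laws of cylindric algebras.

  module CylindricAlgebra (A : Algebra α) (isCA : CA A) where
    open Algebra A using (Carrier; ⊕-cong; ⊖-cong; cyl; diag; cyl-cong)

    booleanAlgebra : BooleanAlgebra ℓ ℓ
    booleanAlgebra = record
      { isBooleanAlgebra = boolean⇒isBooleanAlgebra A (λ ax → isCA (boolean ax)) }

    open BooleanAlgebra booleanAlgebra hiding (Carrier) renaming (¬_ to ∁_)
    open BooleanAlgebraProperties booleanAlgebra
    open SetoidReasoning setoid

    private
      val : Carrier → Carrier → ℕ → Carrier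
      val x y zero    = x
      val x y (suc _) = y

    cyl-swap : ∀ i j x → cyl i (cyl j x) ≈ cyl j (cyl i x)
    cyl-swap i j x with i ≟ j
    ... | yes ≡.refl = refl
    ... | no  i≢j    = isCA (c-comm i≢j) (val x x)

    cyl-∨ : ∀ i x y → cyl i (x ∨ y) ≈ cyl i x ∨ cyl i y
    cyl-∨ i x y = isCA c-+ (val x y)

    cyl-cyl : ∀ i x → cyl i (cyl i x) ≈ cyl i x
    cyl-cyl i x = sym (isCA c-idem (val x x))

    diag-refl : ∀ i → diag i i ≈ ⊤
    diag-refl i = isCA d-refl (val ⊤ ⊤)

    diag-sym : ∀ i j → diag i j ≈ diag j i
    diag-sym i j with i ≟ j
    ... | yes ≡.refl = refl
    ... | no  i≢j    = isCA (d-sym i≢j) (val ⊤ ⊤)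

    Closed : Index → Carrier → Set ℓ
    Closed i x = cyl i x ≈ x

    closed-∨ : ∀ {i x y} → Closed i x → Closed i y → Closed i (x ∨ y)
    closed-∨ {i} {x} {y} cx cy = trans (cyl-∨ i x y) (∨-cong cx cy)

    closed-∁ : ∀ {i x} → Closed i x → Closed i (∁ x)
    closed-∁ {i} {x} cx = begin
      cyl i (∁ x)       ≈⟨ cyl-cong i (¬-cong cx) ⟨
      cyl i (∁ cyl i x) ≈⟨ isCA c-compl (val x x) ⟩
      ∁ cyl i x         ≈⟨ ¬-cong cx ⟩
      ∁ x               ∎

    closed-cyl : ∀ {i} j {x} → Closed i x → Closed i (cyl j x)
    closed-cyl {i} j {x} cx = trans (cyl-swap i j x) (cyl-cong j cx)

    closed-⊤ : ∀ {i} → Closed i ⊤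
    closed-⊤ {i} = begin
      cyl i ⊤           ≈⟨ ∨-identityˡ _ ⟨
      ⊥ ∨ cyl i ⊤       ≈⟨ ∨-cong ¬⊤≈⊥ refl ⟨
      ∁ ⊤ ∨ cyl i ⊤     ≈⟨ ∨-cong refl (isCA c-incr (val ⊤ ⊤)) ⟨
      ∁ ⊤ ∨ (⊤ ∨ cyl i ⊤) ≈⟨ ∨-assoc _ _ _ ⟨
      (∁ ⊤ ∨ ⊤) ∨ cyl i ⊤ ≈⟨ ∨-cong (∨-complementˡ ⊤) refl ⟩
      ⊤ ∨ cyl i ⊤       ≈⟨ ∨-zeroˡ _ ⟩
      ⊤                 ∎

    closed-⊥ : ∀ {i} → Closed i ⊥
    closed-⊥ = closed-∁ closed-⊤

    -- For distinct `k` and `l`, the axiom `d-trans` with middle index `i` presents the diagonal as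
    -- a cylindrification along `i`.
    closed-diag : ∀ {i k l} → k ≢ i → l ≢ i → Closed i (diag k l)
    closed-diag {i} {k} {l} k≢i l≢i with k ≟ l
    ... | yes ≡.refl = trans (cyl-cong i (diag-refl k)) (trans closed-⊤ (sym (diag-refl k)))
    ... | no  k≢l    = begin
      cyl i (diag k l)                        ≈⟨ cyl-cong i dkl ⟨
      cyl i (cyl i (diag k i ∧ diag i l))     ≈⟨ cyl-cyl i _ ⟩
      cyl i (diag k i ∧ diag i l)             ≈⟨ dkl ⟩
      diag k l                                ∎
      where
      dkl : cyl i (diag k i ∧ diag i l) ≈ diag k l
      dkl = isCA (d-trans k≢i k≢l (l≢i ∘ ≡.sym)) (val ⊤ ⊤)

    complement-unique : ∀ {x y} → x ∧ y ≈ ⊥ → x ∨ y ≈ ⊤ → y ≈ ∁ x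
    complement-unique {x} {y} x∧y x∨y = begin
      y                       ≈⟨ ∧-identityˡ y ⟨
      ⊤ ∧ y                   ≈⟨ ∧-cong (∨-complementʳ x) refl ⟨
      (x ∨ ∁ x) ∧ y           ≈⟨ ∧-distribʳ-∨ y x (∁ x) ⟩
      (x ∧ y) ∨ (∁ x ∧ y)     ≈⟨ ∨-cong (trans x∧y (sym (∧-complementˡ x))) refl ⟩
      (∁ x ∧ x) ∨ (∁ x ∧ y)   ≈⟨ ∧-distribˡ-∨ (∁ x) x y ⟨
      ∁ x ∧ (x ∨ y)           ≈⟨ ∧-cong refl x∨y ⟩
      ∁ x ∧ ⊤                 ≈⟨ ∧-identityʳ _ ⟩
      ∁ x                     ∎

    cyl-∧-below : ∀ {i u} x → Closed i u → cyl i (x ∧ u) ∨ u ≈ u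
    cyl-∧-below {i} {u} x cu = begin
      cyl i (x ∧ u) ∨ u        ≈⟨ ∨-cong refl cu ⟨
      cyl i (x ∧ u) ∨ cyl i u  ≈⟨ cyl-∨ i _ _ ⟨
      cyl i ((x ∧ u) ∨ u)      ≈⟨ cyl-cong i (∨-comm _ _) ⟩
      cyl i (u ∨ (x ∧ u))      ≈⟨ cyl-cong i (∨-cong refl (∧-comm _ _)) ⟩
      cyl i (u ∨ (u ∧ x))      ≈⟨ cyl-cong i (∨-absorbs-∧ u x) ⟩
      cyl i u                  ≈⟨ cu ⟩
      u                        ∎

    below⇒∧ : ∀ {x u} → x ∨ u ≈ u → x ∧ u ≈ x
    below⇒∧ {x} {u} x≤u = trans (∧-cong refl (sym x≤u)) (∧-absorbs-∨ x u)

    -- Often an axiom, in the form c_i(x · c_i y) = c_i x · c_i y. Here `x` is split by `u`: the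
    -- part below `∁ u` stays below it under `cyl i`, because complements of closed elements are
    -- closed, and so the meet with `u` removes it.
    cyl-∧ : ∀ {i u} x → Closed i u → cyl i (x ∧ u) ≈ cyl i x ∧ u
    cyl-∧ {i} {u} x cu = sym (begin
      cyl i x ∧ u                                    ≈⟨ ∧-cong (cyl-cong i split) refl ⟩
      cyl i ((x ∧ u) ∨ (x ∧ ∁ u)) ∧ u                ≈⟨ ∧-cong (cyl-∨ i _ _) refl ⟩
      (cyl i (x ∧ u) ∨ cyl i (x ∧ ∁ u)) ∧ u          ≈⟨ ∧-distribʳ-∨ u _ _ ⟩
      (cyl i (x ∧ u) ∧ u) ∨ (cyl i (x ∧ ∁ u) ∧ u)    ≈⟨ ∨-cong (below⇒∧ (cyl-∧-below x cu)) disjoint ⟩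
      cyl i (x ∧ u) ∨ ⊥                              ≈⟨ ∨-identityʳ _ ⟩
      cyl i (x ∧ u)                                  ∎)
      where
      split : x ≈ (x ∧ u) ∨ (x ∧ ∁ u)
      split = begin
        x                     ≈⟨ ∧-identityʳ x ⟨
        x ∧ ⊤                 ≈⟨ ∧-cong refl (∨-complementʳ u) ⟨
        x ∧ (u ∨ ∁ u)         ≈⟨ ∧-distribˡ-∨ x u (∁ u) ⟩
        (x ∧ u) ∨ (x ∧ ∁ u)   ∎
      disjoint : cyl i (x ∧ ∁ u) ∧ u ≈ ⊥
      disjoint = begin
        cyl i (x ∧ ∁ u) ∧ u           ≈⟨ ∧-cong (below⇒∧ (cyl-∧-below x (closed-∁ cu))) refl ⟨
        (cyl i (x ∧ ∁ u) ∧ ∁ u) ∧ u   ≈⟨ ∧-assoc _ _ _ ⟩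
        cyl i (x ∧ ∁ u) ∧ (∁ u ∧ u)   ≈⟨ ∧-cong refl (∧-complementˡ u) ⟩
        cyl i (x ∧ ∁ u) ∧ ⊥           ≈⟨ ∧-zeroʳ _ ⟩
        ⊥                             ∎

    -- Closedness is asked only of the values of variables occurring in `t`: local finiteness
    -- provides a common fresh index for finitely many elements, not for a whole assignment.
    term-closed : ∀ {i} t {ρ} → i ∉ indices t → (∀ v → v ∈ variables t → Closed i (ρ v)) →
                  Closed i (⟦_⟧ A t ρ)
    term-closed (var v) i∉ cl = cl v (here ≡.refl)
    term-closed (s + t) i∉ cl = closed-∨
      (term-closed s (i∉ ∘ ∈-++⁺ˡ) (λ v → cl v ∘ ∈-++⁺ˡ))
      (term-closed t (i∉ ∘ ∈-++⁺ʳ (indices s)) (λ v → cl v ∘ ∈-++⁺ʳ (variables s)))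
    term-closed (- t)   i∉ cl = closed-∁ (term-closed t i∉ cl)
    term-closed (c k t) i∉ cl = closed-cyl k (term-closed t (i∉ ∘ there) cl)
    term-closed (d k l) i∉ cl =
      closed-diag (i∉ ∘ here ∘ ≡.sym) (i∉ ∘ there ∘ here ∘ ≡.sym)

    -- Substitution of one index for another.

    -- The operation s^i_j: x with the index i replaced by j.
    substitute : Index → Index → Carrier → Carrier
    substitute i j x = cyl i (diag i j ∧ x)

    substitute-cong : ∀ i j {x y} → x ≈ y → substitute i j x ≈ substitute i j y
    substitute-cong i j x≈y = cyl-cong i (∧-cong refl x≈y)

    substitute-closed : ∀ i j x → Closed i (substitute i j x)
    substitute-closed i j x = cyl-cyl i _

    module _ {i j : Index} (i≢j : i ≢ j) where

      cyl-diagˡ : cyl i (diag i j) ≈ ⊤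
      cyl-diagˡ = isCA (c-d i≢j) (val ⊤ ⊤)

      cyl-diagʳ : cyl j (diag i j) ≈ ⊤
      cyl-diagʳ = trans (cyl-cong j (diag-sym i j)) (isCA (c-d (i≢j ∘ ≡.sym)) (val ⊤ ⊤))

      substitute-fixes : ∀ {x} → Closed i x → substitute i j x ≈ x
      substitute-fixes {x} cx = begin
        cyl i (diag i j ∧ x) ≈⟨ cyl-∧ _ cx ⟩
        cyl i (diag i j) ∧ x ≈⟨ ∧-cong cyl-diagˡ refl ⟩
        ⊤ ∧ x                ≈⟨ ∧-identityˡ x ⟩
        x                    ∎

      substitute-∨ : ∀ x y → substitute i j (x ∨ y) ≈ substitute i j x ∨ substitute i j y
      substitute-∨ x y = trans (cyl-cong i (∧-distribˡ-∨ _ x y)) (cyl-∨ i _ _)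

      -- One factor is closed under `cyl i` and moves inside the other. There it meets the diagonal,
      -- where by `d-c` it agrees with `x`, so it meets `∁ x` in `⊥`.
      substitute-∧-∁ : ∀ x → substitute i j x ∧ substitute i j (∁ x) ≈ ⊥
      substitute-∧-∁ x = begin
        substitute i j x ∧ substitute i j (∁ x)        ≈⟨ ∧-comm _ _ ⟩
        substitute i j (∁ x) ∧ substitute i j x        ≈⟨ cyl-∧ _ (substitute-closed i j x) ⟨
        cyl i ((diag i j ∧ ∁ x) ∧ substitute i j x)    ≈⟨ cyl-cong i (∧-cong (∧-comm _ _) refl) ⟩
        cyl i ((∁ x ∧ diag i j) ∧ substitute i j x)    ≈⟨ cyl-cong i (∧-assoc _ _ _) ⟩
        cyl i (∁ x ∧ (diag i j ∧ substitute i j x))    ≈⟨ cyl-cong i (∧-cong refl (isCA (d-c i≢j) (val x x))) ⟩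
        cyl i (∁ x ∧ (diag i j ∧ x))                   ≈⟨ cyl-cong i (∧-cong refl (∧-comm _ _)) ⟩
        cyl i (∁ x ∧ (x ∧ diag i j))                   ≈⟨ cyl-cong i (∧-assoc _ _ _) ⟨
        cyl i ((∁ x ∧ x) ∧ diag i j)                   ≈⟨ cyl-cong i (∧-cong (∧-complementˡ x) refl) ⟩
        cyl i (⊥ ∧ diag i j)                           ≈⟨ cyl-cong i (∧-zeroˡ _) ⟩
        cyl i ⊥                                        ≈⟨ closed-⊥ ⟩
        ⊥                                              ∎

      substitute-∨-∁ : ∀ x → substitute i j x ∨ substitute i j (∁ x) ≈ ⊤
      substitute-∨-∁ x = begin
        substitute i j x ∨ substitute i j (∁ x) ≈⟨ substitute-∨ x (∁ x) ⟨
        substitute i j (x ∨ ∁ x)                ≈⟨ substitute-cong i j (∨-complementʳ x) ⟩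
        substitute i j ⊤                        ≈⟨ substitute-fixes closed-⊤ ⟩
        ⊤                                       ∎

      substitute-∁ : ∀ x → substitute i j (∁ x) ≈ ∁ substitute i j x
      substitute-∁ x = complement-unique (substitute-∧-∁ x) (substitute-∨-∁ x)

      substitute-cyl : ∀ {k} x → k ≢ i → k ≢ j →
                       substitute i j (cyl k x) ≈ cyl k (substitute i j x)
      substitute-cyl {k} x k≢i k≢j = begin
        cyl i (diag i j ∧ cyl k x)     ≈⟨ cyl-cong i (∧-comm _ _) ⟩
        cyl i (cyl k x ∧ diag i j)     ≈⟨ cyl-cong i (cyl-∧ x (closed-diag (k≢i ∘ ≡.sym) (k≢j ∘ ≡.sym))) ⟨
        cyl i (cyl k (x ∧ diag i j))   ≈⟨ cyl-swap i k _ ⟩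
        cyl k (cyl i (x ∧ diag i j))   ≈⟨ cyl-cong k (cyl-cong i (∧-comm _ _)) ⟩
        cyl k (cyl i (diag i j ∧ x))   ∎

      -- Renaming of a bound coordinate. As `x` does not depend on `j`, it equals
      -- `cyl j (diag i j ∧ x)`, and the two cylindrifications commute.
      substitute-cylˡ : ∀ {x} → Closed j x →
                        substitute i j (cyl i x) ≈ cyl j (substitute i j x)
      substitute-cylˡ {x} cx = begin
        substitute i j (cyl i x)       ≈⟨ substitute-fixes (cyl-cyl i x) ⟩
        cyl i x                        ≈⟨ cyl-cong i (∧-identityˡ x) ⟨
        cyl i (⊤ ∧ x)                  ≈⟨ cyl-cong i (∧-cong cyl-diagʳ refl) ⟨
        cyl i (cyl j (diag i j) ∧ x)   ≈⟨ cyl-cong i (cyl-∧ _ cx) ⟨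
        cyl i (cyl j (diag i j ∧ x))   ≈⟨ cyl-swap i j _ ⟩
        cyl j (substitute i j x)       ∎

      substitute-diagˡ : ∀ {k} → k ≢ i → k ≢ j → substitute i j (diag i k) ≈ diag j k
      substitute-diagˡ {k} k≢i k≢j = begin
        cyl i (diag i j ∧ diag i k)  ≈⟨ cyl-cong i (∧-cong (diag-sym i j) refl) ⟩
        cyl i (diag j i ∧ diag i k)  ≈⟨ isCA (d-trans (i≢j ∘ ≡.sym) (k≢j ∘ ≡.sym) (k≢i ∘ ≡.sym)) (val ⊤ ⊤) ⟩
        diag j k                     ∎

      substitute-diag : ∀ k l → k ≢ j → l ≢ j →
                        substitute i j (diag k l) ≈ diag (replace i j k) (replace i j l)
      substitute-diag k l k≢j l≢j with k ≟ i | l ≟ i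
      ... | yes ≡.refl | yes ≡.refl = begin
        substitute i j (diag i i)  ≈⟨ substitute-cong i j (diag-refl i) ⟩
        substitute i j ⊤           ≈⟨ substitute-fixes closed-⊤ ⟩
        ⊤                          ≈⟨ diag-refl j ⟨
        diag j j                   ∎
      ... | yes ≡.refl | no  l≢i    = substitute-diagˡ l≢i l≢j
      ... | no  k≢i    | yes ≡.refl = begin
        substitute i j (diag k i)  ≈⟨ substitute-cong i j (diag-sym k i) ⟩
        substitute i j (diag i k)  ≈⟨ substitute-diagˡ k≢i k≢j ⟩
        diag j k                   ≈⟨ diag-sym j k ⟩
        diag k j                   ∎
      ... | no  k≢i    | no  l≢i    = substitute-fixes (closed-diag k≢i l≢i)

      -- Substituting back, `j` by `i`, is a left inverse on the elements closed under `cyl j`.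
      substitute-injective : ∀ {x y} → Closed j x → Closed j y →
                             substitute i j x ≈ substitute i j y → x ≈ y
      substitute-injective cx cy eq =
        trans (sym (retract cx)) (trans (cyl-cong j (∧-cong refl eq)) (retract cy))
        where
        retract : ∀ {x} → Closed j x → cyl j (diag i j ∧ substitute i j x) ≈ x
        retract {x} cx = begin
          cyl j (diag i j ∧ substitute i j x) ≈⟨ cyl-cong j (isCA (d-c i≢j) (val x x)) ⟩
          cyl j (diag i j ∧ x)                ≈⟨ cyl-∧ _ cx ⟩
          cyl j (diag i j) ∧ x                ≈⟨ ∧-cong cyl-diagʳ refl ⟩
          ⊤ ∧ x                               ≈⟨ ∧-identityˡ x ⟩
          x                                   ∎

      -- Freshness of `j` excludes capture: no `cyl j` occurs in `t`, and below each `cyl i` the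
      -- value is closed under `cyl j`, so the bound `i` can become `j`.
      substitute-term : ∀ t {ρ} → j ∉ indices t → (∀ v → v ∈ variables t → Closed j (ρ v)) →
        substitute i j (⟦_⟧ A t ρ) ≈ ⟦_⟧ A (rename i j t) (substitute i j ∘ ρ)
      substitute-term (var v) j∉ cl = refl
      substitute-term (s + t) j∉ cl = trans (substitute-∨ _ _) (∨-cong
        (substitute-term s (j∉ ∘ ∈-++⁺ˡ) (λ v → cl v ∘ ∈-++⁺ˡ))
        (substitute-term t (j∉ ∘ ∈-++⁺ʳ (indices s)) (λ v → cl v ∘ ∈-++⁺ʳ (variables s))))
      substitute-term (- t)   j∉ cl = trans (substitute-∁ _) (¬-cong (substitute-term t j∉ cl))
      substitute-term (c k t) j∉ cl with k ≟ i
      ... | yes ≡.refl = trans (substitute-cylˡ (term-closed t (j∉ ∘ there) cl))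
                               (cyl-cong j (substitute-term t (j∉ ∘ there) cl))
      ... | no  k≢i    = trans (substitute-cyl _ k≢i (j∉ ∘ here ∘ ≡.sym))
                               (cyl-cong k (substitute-term t (j∉ ∘ there) cl))
      substitute-term (d k l) j∉ cl =
        substitute-diag k l (j∉ ∘ here ∘ ≡.sym) (j∉ ∘ there ∘ here ∘ ≡.sym)

  -- Invariance of inductive theories under renaming.

  fin-injective : ∀ {m n} → fin m ≡ fin n → m ≡ n
  fin-injective {m} {n} eq with ℕ.<-cmp m n
  ... | tri< m<n _ _ = ⊥-elim (irrefl eq (fin-mono m<n))
  ... | tri≈ _ m≡n _ = m≡n
  ... | tri> _ _ n<m = ⊥-elim (irrefl (≡.sym eq) (fin-mono n<m))

  indices-rename : ∀ i j (t : Term α) → indices (rename i j t) ≡ map (replace i j) (indices t)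
  indices-rename i j (var v) = ≡.refl
  indices-rename i j (s + t) =
    ≡.trans (≡.cong₂ _++_ (indices-rename i j s) (indices-rename i j t))
            (≡.sym (map-++ (replace i j) (indices s) (indices t)))
  indices-rename i j (- t)   = indices-rename i j t
  indices-rename i j (c k t) = ≡.cong (replace i j k ∷_) (indices-rename i j t)
  indices-rename i j (d k l) = ≡.refl

  indices-renameₑ : ∀ i j (e : Equation α) → indicesₑ (renameₑ i j e) ≡ map (replace i j) (indicesₑ e)
  indices-renameₑ i j (s ≈ₑ t) =
    ≡.trans (≡.cong₂ _++_ (indices-rename i j s) (indices-rename i j t))
            (≡.sym (map-++ (replace i j) (indices s) (indices t)))

  ∈-indices-renameₑ : ∀ i j {k} (e : Equation α) → k ∈ indicesₑ (renameₑ i j e) →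
                      k ≡ j ⊎ (k ≢ i × k ∈ indicesₑ e)
  ∈-indices-renameₑ i j e k∈
    with l , l∈ , ≡.refl ← ∈-map⁻ (replace i j) (≡.subst (_ ∈_) (indices-renameₑ i j e) k∈)
    with l ≟ i
  ... | yes _   = inj₁ ≡.refl
  ... | no  l≢i = inj₂ (l≢i , l∈)

  rename-absent : ∀ {i j} (t : Term α) → i ∉ indices t → rename i j t ≡ t
  rename-absent (var v) i∉ = ≡.refl
  rename-absent (s + t) i∉ = ≡.cong₂ _+_ (rename-absent s (i∉ ∘ ∈-++⁺ˡ))
                                         (rename-absent t (i∉ ∘ ∈-++⁺ʳ (indices s)))
  rename-absent (- t)   i∉ = ≡.cong -_ (rename-absent t i∉)
  rename-absent (c k t) i∉ = ≡.cong₂ c (replace-other (i∉ ∘ here ∘ ≡.sym))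
                                       (rename-absent t (i∉ ∘ there))
  rename-absent (d k l) i∉ = ≡.cong₂ d (replace-other (i∉ ∘ here ∘ ≡.sym))
                                       (replace-other (i∉ ∘ there ∘ here ∘ ≡.sym))

  replace-inverse : ∀ {i j k} → k ≢ j → replace j i (replace i j k) ≡ k
  replace-inverse {i} {j} {k} k≢j with k ≟ i
  ... | yes ≡.refl = replace-same
  ... | no  _      = replace-other k≢j

  rename-inverse : ∀ {i j} (t : Term α) → j ∉ indices t → rename j i (rename i j t) ≡ t
  rename-inverse (var v) j∉ = ≡.refl
  rename-inverse (s + t) j∉ = ≡.cong₂ _+_ (rename-inverse s (j∉ ∘ ∈-++⁺ˡ))
                                          (rename-inverse t (j∉ ∘ ∈-++⁺ʳ (indices s)))
  rename-inverse (- t)   j∉ = ≡.cong -_ (rename-inverse t j∉)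
  rename-inverse (c k t) j∉ = ≡.cong₂ c (replace-inverse (j∉ ∘ here ∘ ≡.sym))
                                        (rename-inverse t (j∉ ∘ there))
  rename-inverse (d k l) j∉ = ≡.cong₂ d (replace-inverse (j∉ ∘ here ∘ ≡.sym))
                                        (replace-inverse (j∉ ∘ there ∘ here ∘ ≡.sym))

  renameₑ-inverse : ∀ {i j} (e : Equation α) → j ∉ indicesₑ e → renameₑ j i (renameₑ i j e) ≡ e
  renameₑ-inverse (s ≈ₑ t) j∉ = ≡.cong₂ _≈ₑ_ (rename-inverse s (j∉ ∘ ∈-++⁺ˡ))
                                            (rename-inverse t (j∉ ∘ ∈-++⁺ʳ (indices s)))

  module _ (A : Algebra α) where
    open Algebra A

    eval-cylVars : ∀ i t ρ → ⟦_⟧ A (t [ (λ v → c i (var v)) ]) ρ ≡ ⟦_⟧ A t (cyl i ∘ ρ)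
    eval-cylVars i (var v) ρ = ≡.refl
    eval-cylVars i (s + t) ρ = ≡.cong₂ _⊕_ (eval-cylVars i s ρ) (eval-cylVars i t ρ)
    eval-cylVars i (- t)   ρ = ≡.cong ⊖_ (eval-cylVars i t ρ)
    eval-cylVars i (c k t) ρ = ≡.cong (cyl k) (eval-cylVars i t ρ)
    eval-cylVars i (d k l) ρ = ≡.refl

    eval-cong : ∀ t {ρ ρ′} → (∀ v → ρ v ≈ ρ′ v) → ⟦_⟧ A t ρ ≈ ⟦_⟧ A t ρ′
    eval-cong (var v) ρ≈ = ρ≈ v
    eval-cong (s + t) ρ≈ = ⊕-cong (eval-cong s ρ≈) (eval-cong t ρ≈)
    eval-cong (- t)   ρ≈ = ⊖-cong (eval-cong t ρ≈)
    eval-cong (c k t) ρ≈ = cyl-cong k (eval-cong t ρ≈)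
    eval-cong (d k l) ρ≈ = IsEquivalence.refl isEquivalence

    cylVars-eval : ∀ {i s t} → A ⊨ cylVars i (s ≈ₑ t) →
                   ∀ ρ → (∀ v → cyl i (ρ v) ≈ ρ v) → ⟦_⟧ A s ρ ≈ ⟦_⟧ A t ρ
    cylVars-eval {i} {s} {t} sat ρ closed =
      trans (sym (eval-cong s closed))
        (trans (≡.subst₂ _≈_ (eval-cylVars i s ρ) (eval-cylVars i t ρ) (sat ρ))
               (eval-cong t closed))
      where open IsEquivalence isEquivalence

    module _ (isCA : CA A) where
      open CylindricAlgebra A isCA
      open IsEquivalence isEquivalence

      -- `cylVars j e` is `e` at elements closed under `cyl j`. There `substitute i j` carries both
      -- sides of `e` to the renamed sides and is injective, so equality can be pulled back.
      rename⇒cylVars : ∀ {i j} → i ≢ j → ∀ e → j ∉ indicesₑ e →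
                       A ⊨ renameₑ i j e → A ⊨ cylVars j e
      rename⇒cylVars {i} {j} i≢j (s ≈ₑ t) j∉ sat ρ =
        ≡.subst₂ _≈_ (≡.sym (eval-cylVars j s ρ)) (≡.sym (eval-cylVars j t ρ))
          (substitute-injective i≢j (term-closed s j∉s closed) (term-closed t j∉t closed)
            (trans (substitute-term i≢j s j∉s closed)
              (trans (sat _) (sym (substitute-term i≢j t j∉t closed)))))
        where
        closed : ∀ {xs : List ℕ} v → v ∈ xs → Closed j (cyl j (ρ v))
        closed v _ = cyl-cyl j (ρ v)
        j∉s : j ∉ indices s
        j∉s = j∉ ∘ ∈-++⁺ˡ
        j∉t : j ∉ indices t
        j∉t = j∉ ∘ ∈-++⁺ʳ (indices s)

  module _ {E : Theory {α = α}} (ind : Inductive E) where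
    open Inductive ind

    -- In models of `E` the renamed equation yields only `cylVars j e`. Semantic closure puts this
    -- into `E`, and descent removes the cylindrifications.
    rename-reflects : ∀ {i j} → i ≢ j → ∀ e → j ∉ indicesₑ e → E (renameₑ i j e) → E e
    rename-reflects {i} {j} i≢j e j∉ Ee′ = descent e j j∉ (Equivalence.from (closed _)
      (λ {A} A⊨E → rename⇒cylVars A (A⊨E ∘ cylindric) i≢j e j∉ (A⊨E Ee′)))

    -- After the renaming `i` is fresh in its turn, so the forward direction is `rename-reflects`
    -- with the two indices exchanged.
    rename-invariant : ∀ {i j} → i ≢ j → ∀ e → j ∉ indicesₑ e → E e ⇔ E (renameₑ i j e)
    rename-invariant {i} {j} i≢j e j∉ = mk⇔
      (λ Ee → rename-reflects (i≢j ∘ ≡.sym) (renameₑ i j e) i∉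
                (≡.subst E (≡.sym (renameₑ-inverse e j∉)) Ee))
      (rename-reflects i≢j e j∉)
      where
      i∉ : i ∉ indicesₑ (renameₑ i j e)
      i∉ i∈ with ∈-indices-renameₑ i j e i∈
      ... | inj₁ i≡j       = i≢j i≡j
      ... | inj₂ (i≢i , _) = i≢i ≡.refl

  -- An enumeration of the equations over the indices below ω.

  Finitary : Index → Set ℓ
  Finitary k = ∃[ n ] k ≡ fin n

  -- unpair enumerates ℕ × ℕ along the antidiagonals.
  unpair : ℕ → ℕ × ℕ
  unpair zero    = 0 , 0
  unpair (suc n) with unpair n
  ... | zero  , b = suc b , 0
  ... | suc a , b = a , suc b

  unpair-surjective : ∀ a b → ∃[ n ] unpair n ≡ (a , b)
  unpair-surjective a b = go (a ℕ.+ b) a b ≡.refl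
    where
    -- Stepping back along an antidiagonal lowers `b`; stepping back to the end of the previous one
    -- lowers `s`.
    go : ∀ s a b → a ℕ.+ b ≡ s → ∃[ n ] unpair n ≡ (a , b)
    go s a (suc b) eq with n , p ← go s (suc a) b (≡.trans (≡.sym (ℕ.+-suc a b)) eq) =
      suc n , lemma n p
      where
      lemma : ∀ n → unpair n ≡ (suc a , b) → unpair (suc n) ≡ (a , suc b)
      lemma n p with unpair n
      lemma n ≡.refl | _ = ≡.refl
    go s zero zero eq = 0 , ≡.refl
    go (suc s) (suc a) zero eq with n , p ← go s 0 a (≡.trans (≡.sym (ℕ.+-identityʳ a)) (ℕ.suc-injective eq)) =
      suc n , lemma n p
      where
      lemma : ∀ n → unpair n ≡ (0 , a) → unpair (suc n) ≡ (suc a , 0)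
      lemma n p with unpair n
      lemma n ≡.refl | _ = ≡.refl

  -- The first argument is fuel.
  decodeTerm : ℕ → ℕ → Term α
  decodeTerm zero       m = var 0
  decodeTerm (suc fuel) m with unpair m
  ... | 0 , k = var k
  ... | 1 , k = decodeTerm fuel (proj₁ (unpair k)) + decodeTerm fuel (proj₂ (unpair k))
  ... | 2 , k = - decodeTerm fuel k
  ... | 3 , k = c (fin (proj₁ (unpair k))) (decodeTerm fuel (proj₂ (unpair k)))
  ... | _ , k = d (fin (proj₁ (unpair k))) (fin (proj₂ (unpair k)))

  -- Atoms count 1 because without fuel `decodeTerm` stops before reading the tag.
  depth : Term α → ℕ
  depth (var v) = 1
  depth (s + t) = suc (depth s ⊔ depth t)
  depth (- t)   = suc (depth t)
  depth (c i t) = suc (depth t)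
  depth (d i j) = 1

  -- The code works for every sufficient fuel, so that both summands of a sum can be decoded with
  -- the same amount.
  decodeTerm-surjective : ∀ t → (∀ {k} → k ∈ indices t → Finitary k) →
                          ∃[ m ] (∀ fuel → depth t ≤ fuel → decodeTerm fuel m ≡ t)
  decodeTerm-surjective (var v) _ with m , eq ← unpair-surjective 0 v =
    m , λ { (suc fuel) _ → lemma fuel m eq }
    where
    lemma : ∀ fuel m → unpair m ≡ (0 , v) → decodeTerm (suc fuel) m ≡ var v
    lemma fuel m eq rewrite eq = ≡.refl
  decodeTerm-surjective (s + t) f
    with a , p ← decodeTerm-surjective s (f ∘ ∈-++⁺ˡ)
       | b , q ← decodeTerm-surjective t (f ∘ ∈-++⁺ʳ (indices s))
    with k , eq₁ ← unpair-surjective a b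
    with m , eq ← unpair-surjective 1 k =
    m , λ { (suc fuel) (s≤s le) → lemma fuel m eq
              (p fuel (ℕ.≤-trans (ℕ.m≤m⊔n _ _) le)) (q fuel (ℕ.≤-trans (ℕ.m≤n⊔m (depth s) _) le)) }
    where
    lemma : ∀ fuel m → unpair m ≡ (1 , k) → decodeTerm fuel a ≡ s → decodeTerm fuel b ≡ t →
            decodeTerm (suc fuel) m ≡ s + t
    lemma fuel m eq p q rewrite eq | eq₁ | p | q = ≡.refl
  decodeTerm-surjective (- t) f
    with a , p ← decodeTerm-surjective t f
    with m , eq ← unpair-surjective 2 a =
    m , λ { (suc fuel) (s≤s le) → lemma fuel m eq (p fuel le) }
    where
    lemma : ∀ fuel m → unpair m ≡ (2 , a) → decodeTerm fuel a ≡ t →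
            decodeTerm (suc fuel) m ≡ - t
    lemma fuel m eq p rewrite eq | p = ≡.refl
  decodeTerm-surjective (c i t) f
    with n , ≡.refl ← f (here ≡.refl)
       | b , q ← decodeTerm-surjective t (f ∘ there)
    with k , eq₁ ← unpair-surjective n b
    with m , eq ← unpair-surjective 3 k =
    m , λ { (suc fuel) (s≤s le) → lemma fuel m eq (q fuel le) }
    where
    lemma : ∀ fuel m → unpair m ≡ (3 , k) → decodeTerm fuel b ≡ t →
            decodeTerm (suc fuel) m ≡ c (fin n) t
    lemma fuel m eq q rewrite eq | eq₁ | q = ≡.refl
  decodeTerm-surjective (d i j) f
    with a , ≡.refl ← f (here ≡.refl)
       | b , ≡.refl ← f (there (here ≡.refl))
    with k , eq₁ ← unpair-surjective a b
    with m , eq ← unpair-surjective 4 k =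
    m , λ { (suc fuel) _ → lemma fuel m eq }
    where
    lemma : ∀ fuel m → unpair m ≡ (4 , k) → decodeTerm (suc fuel) m ≡ d (fin a) (fin b)
    lemma fuel m eq rewrite eq | eq₁ = ≡.refl

  -- The code of an equation carries its own fuel.
  decode : ℕ → Equation α
  decode n = decodeTerm fuel (proj₁ (unpair m)) ≈ₑ decodeTerm fuel (proj₂ (unpair m))
    where
    fuel = proj₁ (unpair n)
    m    = proj₂ (unpair n)

  decode-surjective : ∀ e → (∀ {k} → k ∈ indicesₑ e → Finitary k) → ∃[ n ] decode n ≡ e
  decode-surjective (s ≈ₑ t) f
    with a , p ← decodeTerm-surjective s (f ∘ ∈-++⁺ˡ)
       | b , q ← decodeTerm-surjective t (f ∘ ∈-++⁺ʳ (indices s))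
    with m , eq₁ ← unpair-surjective a b
    with n , eq ← unpair-surjective (depth s ⊔ depth t) m =
    n , lemma n eq (p _ (ℕ.m≤m⊔n _ _)) (q _ (ℕ.m≤n⊔m (depth s) _))
    where
    lemma : ∀ {fuel} n → unpair n ≡ (fuel , m) → decodeTerm fuel a ≡ s → decodeTerm fuel b ≡ t →
            decode n ≡ (s ≈ₑ t)
    lemma n eq p q rewrite eq | eq₁ | p | q = ≡.refl

  -- Varieties and their theories.

  Th-closed : ∀ (K : Class {α = α}) e → Th K e ⇔ Th K ⊫ e
  Th-closed K e = mk⇔ {A = Th K e} {B = Th K ⊫ e}
    (λ Ke {A} A⊨ → A⊨ {e} Ke)
    (λ sat {A} KA → sat {A} (λ {e} Ke → Ke {A} KA))

  Th-antitone : ∀ {K L : Class {α = α}} → K ⊆ L → ∀ e → Th L e → Th K e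
  Th-antitone K⊆L e Le {A} KA = Le {A} (K⊆L {A} KA)

  variety⊆ : ∀ {V W : Class {α = α}} → IsVariety W → (∀ e → Th W e → Th V e) → V ⊆ W
  variety⊆ (E , W⊆ , ⊆W) Th⊆ {A} VA =
    ⊆W {A} (λ {e} Ee → Th⊆ e (λ {B} WB → W⊆ {B} WB {e} Ee) {A} VA)

  Mod-isVariety : (E : Theory {α = α}) → IsVariety (Mod E)
  Mod-isVariety E = E , (λ {A} sat {e} → sat {e}) , (λ {A} sat {e} → sat {e})

  Mod-Th-generated : (K : Class {α = α}) → Mod (Th K) IsGeneratedBy K
  Mod-Th-generated K = record
    { isVariety = Mod-isVariety (Th K)
    ; contains  = λ {A} KA {e} Ke → Ke {A} KA
    ; least     = λ W isVar K⊆W →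
        variety⊆ {V = Mod (Th K)} {W} isVar (λ e We {A} sat → sat {e} (Th-antitone {K} {W} K⊆W e We))
    }

  -- `Mod (Th K)` is itself a variety containing `K`, so it contains the least one.
  generated-Th : ∀ {V K : Class {α = α}} → V IsGeneratedBy K → ∀ e → Th K e → Th V e
  generated-Th {V} {K} gen e Ke {A} VA =
    least (Mod (Th K)) (Mod-isVariety (Th K)) (λ {B} KB {e} Ke → Ke {B} KB) {A} VA {e} Ke
    where open _IsGeneratedBy_ gen

  -- Descent in locally finite algebras and the upper bound.

  module _ (em : ∀ {a : Level} → ExcludedMiddle a) where

    -- The induction carries a bound, since a single fresh index might coincide with the next entry.
    fresh-from : (is : List Index) → ∃[ N ] (∀ n → N ≤ n → fin n ∉ is)
    fresh-from []       = 0 , λ _ _ ()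
    fresh-from (i ∷ is) with fresh-from is | em {P = Finitary i}
    ... | N , fr | no ¬fin = N , λ where
      n N≤n (here eq)  → ¬fin (n , ≡.sym eq)
      n N≤n (there n∈) → fr n N≤n n∈
    ... | N , fr | yes (m , ≡.refl) = suc m ⊔ N , λ where
      n le (here eq)  → ℕ.<-irrefl (≡.sym (fin-injective eq)) (ℕ.≤-trans (ℕ.m≤m⊔n (suc m) N) le)
      n le (there n∈) → fr n (ℕ.≤-trans (ℕ.m≤n⊔m (suc m) N) le) n∈

    fresh : (is : List Index) → ∃[ n ] fin n ∉ is
    fresh is with N , fr ← fresh-from is = N , fr N ℕ.≤-refl

    -- Choose `k` outside `e`, distinct from `i`, and outside the supports of the finitely many
    -- values involved. Substituting `k` for `i` makes these values closed under `cyl i`, so the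
    -- hypothesis applies to them; as `i` does not occur in `e`, the substitution commutes with both
    -- sides, and it is injective on elements closed under `cyl k`.
    descent-locallyFinite : ∀ (A : Algebra α) → CA A → LocallyFinite A →
      ∀ e i → i ∉ indicesₑ e → A ⊨ cylVars i e → A ⊨ e
    descent-locallyFinite A isCA lf e@(s ≈ₑ t) i i∉ sat ρ = go (fresh _)
      where
      open Algebra A
      open CylindricAlgebra A isCA
      open IsEquivalence isEquivalence
      support : ℕ → List Index
      support v = proj₁ (lf (ρ v))
      go : ∃[ n ] fin n ∉ i ∷ indicesₑ e ++ concatMap support (variables s ++ variables t) →
           ⟦_⟧ A s ρ ≈ ⟦_⟧ A t ρ
      go (n , k∉) = substitute-injective i≢k
          (term-closed s k∉s closed-s) (term-closed t k∉t closed-t)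
          (trans (substitute-term i≢k s k∉s closed-s)
            (trans eq (sym (substitute-term i≢k t k∉t closed-t))))
        where
        k : Index
        k = fin n
        i≢k : i ≢ k
        i≢k = k∉ ∘ here ∘ ≡.sym
        k∉e : k ∉ indicesₑ e
        k∉e = k∉ ∘ there ∘ ∈-++⁺ˡ
        k∉s : k ∉ indices s
        k∉s = k∉e ∘ ∈-++⁺ˡ
        k∉t : k ∉ indices t
        k∉t = k∉e ∘ ∈-++⁺ʳ (indices s)
        closed : ∀ v → v ∈ variables s ++ variables t → Closed k (ρ v)
        closed v v∈ = proj₂ (lf (ρ v)) k
          (λ k∈ → k∉ (there (∈-++⁺ʳ (indicesₑ e) (∈-concatMap⁺ support (Any.map (λ { ≡.refl → k∈ }) v∈)))))
        closed-s : ∀ v → v ∈ variables s → Closed k (ρ v)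
        closed-s v = closed v ∘ ∈-++⁺ˡ
        closed-t : ∀ v → v ∈ variables t → Closed k (ρ v)
        closed-t v = closed v ∘ ∈-++⁺ʳ (variables s)
        ρ′ : ℕ → Carrier
        ρ′ = substitute i k ∘ ρ
        eq : ⟦_⟧ A (rename i k s) ρ′ ≈ ⟦_⟧ A (rename i k t) ρ′
        eq = ≡.subst₂ (λ s t → ⟦_⟧ A s ρ′ ≈ ⟦_⟧ A t ρ′)
          (≡.sym (rename-absent s (i∉ ∘ ∈-++⁺ˡ))) (≡.sym (rename-absent t (i∉ ∘ ∈-++⁺ʳ (indices s))))
          (cylVars-eval A {s = s} {t} sat ρ′ (λ v → substitute-closed i k (ρ v)))

    -- Members of `V` may fail to be locally finite. For descent the equation is therefore taken
    -- down to `K`, where fresh indices exist, and its conclusion is lifted back by `generated-Th`.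
    generated-inductive : ∀ {V K : Class {α = α}} → K ⊆ ∞Lf → V IsGeneratedBy K →
                          IsInductiveOfInfiniteBase V
    generated-inductive {V} {K} K⊆ gen = isVariety , ind , λ m → generated-Th gen (a[ m ] ≈ₑ 𝟏)
      (λ {A} KA → proj₂ (proj₂ (K⊆ {A} KA)) m)
      where
      open _IsGeneratedBy_ gen
      ind : Inductive (Th V)
      ind = record
        { cylindric = λ {e} ax → generated-Th gen e (λ {A} KA → proj₁ (K⊆ {A} KA) {e} ax)
        ; closed    = Th-closed V
        ; descent   = λ e i i∉ sat → generated-Th gen e λ {A} KA →
            descent-locallyFinite A (proj₁ (K⊆ {A} KA)) (proj₁ (proj₂ (K⊆ {A} KA))) e i i∉
              (sat {A} (contains {A} KA))
        }

    -- `e′` is chosen before `E`, so two inductive theories can be compared at the same finitary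
    -- equation.
    finitary-form : ∀ e → ∃[ e′ ] ((∀ {k} → k ∈ indicesₑ e′ → Finitary k) ×
                                   (∀ {E : Theory {α = α}} → Inductive E → E e ⇔ E e′))
    finitary-form e = go (indicesₑ e) e inj₁
      where
      go : ∀ is e → (∀ {k} → k ∈ indicesₑ e → k ∈ is ⊎ Finitary k) →
           ∃[ e′ ] ((∀ {k} → k ∈ indicesₑ e′ → Finitary k) ×
                    (∀ {E : Theory {α = α}} → Inductive E → E e ⇔ E e′))
      go [] e f = e , (λ k∈ → case f k∈ of λ { (inj₂ fin) → fin }) , λ _ → mk⇔ (λ x → x) (λ x → x)
      go (i ∷ is) e f with n , j∉ ← fresh (i ∷ indicesₑ e)
        with e′ , fin′ , same ← go is (renameₑ i (fin n) e) (λ k∈ →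
          case ∈-indices-renameₑ i (fin n) e k∈ of λ where
            (inj₁ k≡j)        → inj₂ (n , k≡j)
            (inj₂ (k≢i , k∈)) → case f k∈ of λ where
              (inj₁ (here k≡i))  → contradiction k≡i k≢i
              (inj₁ (there k∈is)) → inj₁ k∈is
              (inj₂ fin)         → inj₂ fin) =
        e′ , fin′ , λ ind →
          let step = rename-invariant ind (j∉ ∘ here ∘ ≡.sym) e (j∉ ∘ there)
          in mk⇔ (Equivalence.to (same ind) ∘ Equivalence.to step)
                 (Equivalence.from step ∘ Equivalence.from (same ind))

    inductive↣reals : Injection (InductiveVarietiesOfInfiniteBase α) (ℕ →-setoid Bool)
    inductive↣reals = record
      { to        = λ (V , _) → theoryBits V
      ; cong      = λ {(V , _)} {(W , _)} (V⊆W , W⊆V) n → isYes-⇔ em em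
          (mk⇔ (Th-antitone {W} {V} W⊆V (decode n)) (Th-antitone {V} {W} V⊆W (decode n)))
      ; injective = λ {(V , varV , indV , _)} {(W , varW , indW , _)} eq →
          variety⊆ {V} {W} varW (compare indW indV (≡.sym ∘ eq)) ,
          variety⊆ {W} {V} varV (compare indV indW eq)
      }
      where
      theoryBits : Class → ℕ → Bool
      theoryBits V n = isYes (em {P = Th V (decode n)})
      compare : ∀ {V W} → Inductive (Th V) → Inductive (Th W) →
                (∀ n → theoryBits V n ≡ theoryBits W n) → ∀ e → Th V e → Th W e
      compare {V} {W} indV indW eq e Ve
        with e′ , fin′ , same ← finitary-form e
        with n , ≡.refl ← decode-surjective e′ fin′ =
        Equivalence.from (same indW)
          (isYes-transfer (em {P = Th V (decode n)}) (em {P = Th W (decode n)}) (eq n)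
            (Equivalence.to (same indV) Ve))

  -- Valuations and the separating equations.

  infixl 9 _⟨_≔_⟩

  _⟨_≔_⟩ : ∀ {M : Set} → (Index → M) → Index → M → Index → M
  (s ⟨ i ≔ m ⟩) k with k ≟ i
  ... | yes _ = m
  ... | no  _ = s k

  module _ {M : Set} (s : Index → M) where

    update-same : ∀ i {m} → (s ⟨ i ≔ m ⟩) i ≡ m
    update-same i with i ≟ i
    ... | yes _   = ≡.refl
    ... | no  i≢i = contradiction ≡.refl i≢i

    update-other : ∀ {i k m} → k ≢ i → (s ⟨ i ≔ m ⟩) k ≡ s k
    update-other {i} {k} k≢i with k ≟ i
    ... | yes k≡i = contradiction k≡i k≢i
    ... | no  _   = ≡.refl

  update-update : ∀ {M : Set} (s : Index → M) {i m n} k →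
                  (s ⟨ i ≔ m ⟩ ⟨ i ≔ n ⟩) k ≡ (s ⟨ i ≔ n ⟩) k
  update-update s {i} k with k ≟ i
  ... | yes _   = ≡.refl
  ... | no  k≢i = update-other s k≢i

  update-swap : ∀ {M : Set} (s : Index → M) {i j m n} → i ≢ j → ∀ k →
                (s ⟨ i ≔ m ⟩ ⟨ j ≔ n ⟩) k ≡ (s ⟨ j ≔ n ⟩ ⟨ i ≔ m ⟩) k
  update-swap s {i} {j} {m} {n} i≢j k = go (k ≟ i) (k ≟ j)
    where
    go : Dec (k ≡ i) → Dec (k ≡ j) → (s ⟨ i ≔ m ⟩ ⟨ j ≔ n ⟩) k ≡ (s ⟨ j ≔ n ⟩ ⟨ i ≔ m ⟩) k
    go (yes ≡.refl) _ = ≡.trans (update-other (s ⟨ i ≔ m ⟩) i≢j)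
      (≡.trans (update-same s i) (≡.sym (update-same (s ⟨ j ≔ n ⟩) i)))
    go (no k≢i) (yes ≡.refl) = ≡.trans (update-same (s ⟨ i ≔ m ⟩) j)
      (≡.trans (≡.sym (update-same s j)) (≡.sym (update-other (s ⟨ j ≔ n ⟩) k≢i)))
    go (no k≢i) (no k≢j) = ≡.trans (update-other (s ⟨ i ≔ m ⟩) k≢j)
      (≡.trans (update-other s k≢i) (≡.sym
        (≡.trans (update-other (s ⟨ j ≔ n ⟩) k≢i) (update-other s k≢j))))

  -- The variable stands for a binary relation on the coordinates 0 and 1; it is
  -- cylindrified so that it cannot depend on the coordinate 2.
  edge : Term α
  edge = c (fin 2) (var 0)

  -- path k: some k edges lead from the coordinate 0 to the coordinate 2.
  path : ℕ → Term α
  path 0       = d (fin 0) (fin 2)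
  path (suc k) = c (fin 1) (edge · c (fin 0) (d (fin 0) (fin 1) · path k))

  serial irreflexive : Term α
  serial      = - c (fin 0) (- c (fin 1) edge)
  irreflexive = - c (fin 0) (c (fin 1) (d (fin 0) (fin 1) · edge))

  periodic : ℕ → Term α
  periodic p = - c (fin 0) (c (fin 2) (path p · - d (fin 0) (fin 2)))

  -- The left side vanishes iff for no valuation the relation given by the variable has all three
  -- properties. The coordinates other than 0, 1, 2 act as parameters of that relation.
  noRotation : ℕ → Equation α
  noRotation p = serial · (irreflexive · periodic p) ≈ₑ 𝟎

  module _ {M : Set} (_~_ : M → M → Set) (R : M → M → Set) where

    Path : ℕ → M → M → Set
    Path 0       a b = a ~ b
    Path (suc k) a b = ∃[ m ] (R a m × Path k m b)

    -- For positive `p` and `R` respecting `_~_`, this describes the graph of a fixed-point-free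
    -- permutation whose p-th power is the identity: by seriality every edge extends to a path of
    -- length `p`, which returns to its start, and this makes `R` functional and injective.
    record IsRotation (p : ℕ) : Set where
      field
        isSerial      : ∀ a → ∃[ b ] R a b
        isIrreflexive : ∀ {a b} → R a b → ¬ a ~ b
        isPeriodic    : ∀ {a b} → Path p a b → a ~ b

  -- Set algebras of invariant finitary relations.

  module SetAlgebra (em : ∀ {a : Level} → ExcludedMiddle a) (B : Base) where
    open Base B

    Valuation : Set ℓ
    Valuation = Index → Point

    -- Boolean values reduce the Boolean axioms to truth tables. `support` is only an upper bound
    -- for the relevant coordinates, and `depends` also makes the relation well defined up to `_~_`.
    record Relation : Set ℓ where
      field
        holds     : Valuation → Bool
        support   : List Index
        depends   : ∀ {s s′} → (∀ i → i ∈ support → s i ~ s′ i) → holds s ≡ holds s′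
        invariant : ∀ g s → holds (act g ∘ s) ≡ holds s

    open Relation

    infix 4 _⊩_

    _⊩_ : Valuation → Relation → Set
    s ⊩ X = T (holds X s)

    ⊩-resp : ∀ X {s s′} → (∀ i → s i ~ s′ i) → s ⊩ X → s′ ⊩ X
    ⊩-resp X s~s′ = ≡.subst T (depends X (λ i _ → s~s′ i))

    ⊩-resp-≡ : ∀ X {s s′} → (∀ i → s i ≡ s′ i) → s ⊩ X → s′ ⊩ X
    ⊩-resp-≡ X s≡s′ = ⊩-resp X (λ i → ~-reflexive (s≡s′ i))

    update-cong : ∀ {is : List Index} {s s′ : Valuation} {i m n} → m ~ n → (∀ k → k ∈ is → s k ~ s′ k) →
                  ∀ k → k ∈ is → (s ⟨ i ≔ m ⟩) k ~ (s′ ⟨ i ≔ n ⟩) k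
    update-cong {i = i} m~n s~s′ k k∈ with k ≟ i
    ... | yes _ = m~n
    ... | no  _ = s~s′ k k∈

    update-self : ∀ (s : Valuation) {i m} → m ~ s i → ∀ k → (s ⟨ i ≔ m ⟩) k ~ s k
    update-self s {i} m~ k with k ≟ i
    ... | yes ≡.refl = m~
    ... | no  _      = ~-refl

    act-update : ∀ g (s : Valuation) {i m n} → act g m ~ n → ∀ k →
                 act g ((s ⟨ i ≔ m ⟩) k) ~ ((act g ∘ s) ⟨ i ≔ n ⟩) k
    act-update g s {i} gm~n k with k ≟ i
    ... | yes _ = gm~n
    ... | no  _ = ~-refl

    union : Relation → Relation → Relation
    union X Y = record
      { holds     = λ s → holds X s ∨ᵇ holds Y s
      ; support   = support X ++ support Y
      ; depends   = λ s~s′ → ≡.cong₂ _∨ᵇ_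
          (depends X (λ i → s~s′ i ∘ ∈-++⁺ˡ))
          (depends Y (λ i → s~s′ i ∘ ∈-++⁺ʳ (support X)))
      ; invariant = λ g s → ≡.cong₂ _∨ᵇ_ (invariant X g s) (invariant Y g s)
      }

    complement : Relation → Relation
    complement X = record
      { holds     = not ∘ holds X
      ; support   = support X
      ; depends   = ≡.cong not ∘ depends X
      ; invariant = λ g s → ≡.cong not (invariant X g s)
      }

    cylinder : Index → Relation → Relation
    cylinder i X = record
      { holds     = λ s → isYes (em {P = ∃[ m ] (s ⟨ i ≔ m ⟩ ⊩ X)})
      ; support   = support X
      ; depends   = λ s~s′ → isYes-⇔ em em (mk⇔
          (λ (m , h) → m , ≡.subst T (depends X (update-cong ~-refl s~s′)) h)
          (λ (m , h) → m , ≡.subst T (≡.sym (depends X (update-cong ~-refl s~s′))) h))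
      -- A witness for the moved valuation is pulled back by surjectivity of `act g`; a witness for
      -- the original one is moved by `act g`.
      ; invariant = λ g s → isYes-⇔ em em (mk⇔
          (λ (m , h) → let (n , gn~m) = act-surjective g m in
             n , ≡.subst T (invariant X g (s ⟨ i ≔ n ⟩))
                   (⊩-resp X (~-sym ∘ act-update g s gn~m) h))
          (λ (m , h) → act g m ,
             ⊩-resp X (act-update g s ~-refl)
               (≡.subst T (≡.sym (invariant X g (s ⟨ i ≔ m ⟩))) h)))
      }

    diagonal : Index → Index → Relation
    diagonal i j = record
      { holds     = λ s → isYes (em {P = s i ~ s j})
      ; support   = i ∷ j ∷ []
      ; depends   = λ s~s′ →
          let i~ = s~s′ i (here ≡.refl) ; j~ = s~s′ j (there (here ≡.refl)) in
          isYes-⇔ em em (mk⇔ (λ h → ~-trans (~-sym i~) (~-trans h j~))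
                             (λ h → ~-trans i~ (~-trans h (~-sym j~))))
      ; invariant = λ g s → isYes-⇔ em em (mk⇔ (act-reflects g) (act-cong g))
      }

    setAlgebra : Algebra α
    setAlgebra = record
      { Carrier       = Relation
      ; _≈_           = λ X Y → ∀ s → holds X s ≡ holds Y s
      ; isEquivalence = record
        { refl  = λ s → ≡.refl
        ; sym   = λ X≈Y s → ≡.sym (X≈Y s)
        ; trans = λ X≈Y Y≈Z s → ≡.trans (X≈Y s) (Y≈Z s)
        }
      ; _⊕_           = union
      ; ⊖_            = complement
      ; cyl           = cylinder
      ; diag          = diagonal
      ; ⊕-cong        = λ X≈X′ Y≈Y′ s → ≡.cong₂ _∨ᵇ_ (X≈X′ s) (Y≈Y′ s)
      ; ⊖-cong        = λ X≈X′ s → ≡.cong not (X≈X′ s)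
      ; cyl-cong      = λ i X≈X′ s → isYes-⇔ em em (mk⇔
          (λ (m , h) → m , ≡.subst T (X≈X′ _) h)
          (λ (m , h) → m , ≡.subst T (≡.sym (X≈X′ _)) h))
      }

    ⊩-cylinder⁺ : ∀ {s i m} X → s ⟨ i ≔ m ⟩ ⊩ X → s ⊩ cylinder i X
    ⊩-cylinder⁺ X h = fromWitness (_ , h)

    ⊩-cylinder⁻ : ∀ {s i} X → s ⊩ cylinder i X → ∃[ m ] (s ⟨ i ≔ m ⟩ ⊩ X)
    ⊩-cylinder⁻ X = toWitness

    ⊩-diagonal⁺ : ∀ (s : Valuation) i j → s i ~ s j → s ⊩ diagonal i j
    ⊩-diagonal⁺ s i j = fromWitness

    ⊩-diagonal⁻ : ∀ (s : Valuation) i j → s ⊩ diagonal i j → s i ~ s j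
    ⊩-diagonal⁻ s i j = toWitness

    _∩ᴿ_ : Relation → Relation → Relation
    _∩ᴿ_ = _⊙_ setAlgebra

    ⊩-unit : ∀ s → s ⊩ unit setAlgebra
    ⊩-unit s = go (holds (diagonal (fin 0) (fin 0)) s)
      where
      go : ∀ b → T (b ∨ᵇ not b)
      go true  = _
      go false = _

    setAlgebra-boolean : Mod BooleanAxiom setAlgebra
    setAlgebra-boolean ax ρ s = go ax
      where
      v : ℕ → Bool
      v n = holds (ρ n) s
      _∧′_ : Bool → Bool → Bool
      a ∧′ b = not (not a ∨ᵇ not b)
      taut : (f g : Bool → Bool → Bool → Bool) {_ : T (agree₃ f g)} →
             f (v 0) (v 1) (v 2) ≡ g (v 0) (v 1) (v 2)
      taut f g {p} = tautology₃ f g {p} (v 0) (v 1) (v 2)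
      -- The constant `𝟏` contains a diagonal; its truth value takes the slot of the second variable
      -- in the complement laws.
      e : Bool
      e = holds (diagonal (fin 0) (fin 0)) s
      tautᵉ : (f g : Bool → Bool → Bool → Bool) {_ : T (agree₃ f g)} →
             f (v 0) e (v 2) ≡ g (v 0) e (v 2)
      tautᵉ f g {p} = tautology₃ f g {p} (v 0) e (v 2)
      go : ∀ {l r} → BooleanAxiom (l ≈ₑ r) →
           holds (⟦_⟧ setAlgebra l ρ) s ≡ holds (⟦_⟧ setAlgebra r ρ) s
      go +-comm        = taut (λ x y z → x ∨ᵇ y) (λ x y z → y ∨ᵇ x)
      go +-assoc       = taut (λ x y z → (x ∨ᵇ y) ∨ᵇ z) (λ x y z → x ∨ᵇ (y ∨ᵇ z))
      go ·-comm        = taut (λ x y z → x ∧′ y) (λ x y z → y ∧′ x)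
      go ·-assoc       = taut (λ x y z → (x ∧′ y) ∧′ z) (λ x y z → x ∧′ (y ∧′ z))
      go +-absorbs-·   = taut (λ x y z → x ∨ᵇ (x ∧′ y)) (λ x y z → x)
      go ·-absorbs-+   = taut (λ x y z → x ∧′ (x ∨ᵇ y)) (λ x y z → x)
      go +-distribˡ-·  = taut (λ x y z → x ∨ᵇ (y ∧′ z)) (λ x y z → (x ∨ᵇ y) ∧′ (x ∨ᵇ z))
      go +-distribʳ-·  = taut (λ x y z → (y ∧′ z) ∨ᵇ x) (λ x y z → (y ∨ᵇ x) ∧′ (z ∨ᵇ x))
      go ·-distribˡ-+  = taut (λ x y z → x ∧′ (y ∨ᵇ z)) (λ x y z → (x ∧′ y) ∨ᵇ (x ∧′ z))
      go ·-distribʳ-+  = taut (λ x y z → (y ∨ᵇ z) ∧′ x) (λ x y z → (y ∧′ x) ∨ᵇ (z ∧′ x))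
      go +-complementˡ = tautᵉ (λ x y z → not x ∨ᵇ x) (λ x y z → y ∨ᵇ not y)
      go +-complementʳ = tautᵉ (λ x y z → x ∨ᵇ not x) (λ x y z → y ∨ᵇ not y)
      go ·-complementˡ = tautᵉ (λ x y z → not x ∧′ x) (λ x y z → not (y ∨ᵇ not y))
      go ·-complementʳ = tautᵉ (λ x y z → x ∧′ not x) (λ x y z → not (y ∨ᵇ not y))

    ⊩-cylinder-swap : ∀ {s i j} X → i ≢ j → s ⊩ cylinder i (cylinder j X) → s ⊩ cylinder j (cylinder i X)
    ⊩-cylinder-swap {s} {i} {j} X i≢j h
      with m , h₁ ← ⊩-cylinder⁻ (cylinder j X) h
      with n , h₂ ← ⊩-cylinder⁻ X h₁ =
      ⊩-cylinder⁺ (cylinder i X) (⊩-cylinder⁺ X (⊩-resp-≡ X (update-swap s i≢j) h₂))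

    setAlgebra-CA : CA setAlgebra
    setAlgebra-CA (boolean ax) = setAlgebra-boolean ax
    setAlgebra-CA (c-comm i≢j) ρ s =
      T-ext (⊩-cylinder-swap (ρ 0) i≢j) (⊩-cylinder-swap (ρ 0) (i≢j ∘ ≡.sym))
    setAlgebra-CA (c-incr {i}) ρ s = T-ext
      (λ h → case T-join⁻ h of λ where
        (inj₁ h) → ⊩-cylinder⁺ (ρ 0) (⊩-resp (ρ 0) (λ k → ~-sym (update-self s ~-refl k)) h)
        (inj₂ h) → h)
      (λ h → T-join⁺ {holds (ρ 0) s} (inj₂ h))
    setAlgebra-CA (c-idem {i}) ρ s = isYes-⇔ em em (mk⇔
      (λ (m , h) → m , ⊩-cylinder⁺ (ρ 0) (⊩-resp-≡ (ρ 0) (λ k → ≡.sym (update-update s k)) h))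
      (λ (m , h) → case ⊩-cylinder⁻ (ρ 0) h of λ (n , h′) →
        n , ⊩-resp-≡ (ρ 0) (update-update s) h′))
    setAlgebra-CA (c-+ {i}) ρ s = T-ext
      (λ h → case ⊩-cylinder⁻ (union (ρ 0) (ρ 1)) h of λ (m , h′) → T-join⁺ (case T-join⁻ h′ of λ where
        (inj₁ h″) → inj₁ (⊩-cylinder⁺ (ρ 0) h″)
        (inj₂ h″) → inj₂ (⊩-cylinder⁺ (ρ 1) h″)))
      (λ h → case T-join⁻ h of λ where
        (inj₁ h′) → case ⊩-cylinder⁻ (ρ 0) h′ of λ (m , h″) →
          ⊩-cylinder⁺ {m = m} (union (ρ 0) (ρ 1)) (T-join⁺ (inj₁ h″))
        (inj₂ h′) → case ⊩-cylinder⁻ (ρ 1) h′ of λ (m , h″) →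
          ⊩-cylinder⁺ {m = m} (union (ρ 0) (ρ 1)) (T-join⁺ {holds (ρ 0) (s ⟨ i ≔ m ⟩)} (inj₂ h″)))
    setAlgebra-CA (c-compl {i}) ρ s = T-ext
      (λ h → case ⊩-cylinder⁻ (complement (cylinder i (ρ 0))) h of λ (m , h′) →
        T-not⁺ (λ h″ → case ⊩-cylinder⁻ (ρ 0) h″ of λ (n , h‴) →
          T-not⁻ h′ (⊩-cylinder⁺ (ρ 0) (⊩-resp-≡ (ρ 0) (λ k → ≡.sym (update-update s k)) h‴))))
      (λ h → ⊩-cylinder⁺ {m = s i} (complement (cylinder i (ρ 0)))
        (T-not⁺ (λ h′ → case ⊩-cylinder⁻ (ρ 0) h′ of λ (n , h″) →
          T-not⁻ h (⊩-cylinder⁺ (ρ 0) (⊩-resp-≡ (ρ 0) (update-update s) h″)))))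
    setAlgebra-CA (d-refl {i}) ρ s = T-ext (λ _ → ⊩-unit s) (λ _ → ⊩-diagonal⁺ s i i ~-refl)
    setAlgebra-CA (d-sym _) ρ s = isYes-⇔ em em (mk⇔ ~-sym ~-sym)
    setAlgebra-CA (d-trans {i} {j} {k} i≢j _ j≢k) ρ s = T-ext
      (λ h → case ⊩-cylinder⁻ (diagonal i j ∩ᴿ diagonal j k) h of λ (m , h′) →
        let (ij , jk) = T-meet⁻ {holds (diagonal i j) (s ⟨ j ≔ m ⟩)} h′
            i~k = ~-trans (⊩-diagonal⁻ (s ⟨ j ≔ m ⟩) i j ij) (⊩-diagonal⁻ (s ⟨ j ≔ m ⟩) j k jk)
        in ⊩-diagonal⁺ s i k (≡.subst₂ _~_ (update-other s i≢j) (update-other s (j≢k ∘ ≡.sym)) i~k))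
      (λ h → ⊩-cylinder⁺ {m = s i} (diagonal i j ∩ᴿ diagonal j k) (T-meet⁺
        (⊩-diagonal⁺ (s ⟨ j ≔ s i ⟩) i j (~-reflexive (≡.trans (update-other s i≢j) (≡.sym (update-same s j)))))
        (⊩-diagonal⁺ (s ⟨ j ≔ s i ⟩) j k (≡.subst₂ _~_ (≡.sym (update-same s j))
          (≡.sym (update-other s (j≢k ∘ ≡.sym))) (⊩-diagonal⁻ s i k h)))))
    setAlgebra-CA (c-d {i} {j} i≢j) ρ s = T-ext (λ _ → ⊩-unit s)
      (λ _ → ⊩-cylinder⁺ {m = s j} (diagonal i j) (⊩-diagonal⁺ (s ⟨ i ≔ s j ⟩) i j (~-reflexive
        (≡.trans (update-same s i) (≡.sym (update-other s (i≢j ∘ ≡.sym)))))))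
    setAlgebra-CA (d-c {i} {j} i≢j) ρ s = T-ext
      (λ h → let (ij , h′) = T-meet⁻ {holds (diagonal i j) s} h in
        case ⊩-cylinder⁻ (diagonal i j ∩ᴿ ρ 0) h′ of λ (m , h″) →
        let (ij′ , h‴) = T-meet⁻ {holds (diagonal i j) (s ⟨ i ≔ m ⟩)} h″
            m~j = ≡.subst₂ _~_ (update-same s i) (update-other s (i≢j ∘ ≡.sym)) (⊩-diagonal⁻ (s ⟨ i ≔ m ⟩) i j ij′)
        in T-meet⁺ ij (⊩-resp (ρ 0) (update-self s (~-trans m~j (~-sym (⊩-diagonal⁻ s i j ij)))) h‴))
      (λ h → let (ij , h′) = T-meet⁻ {holds (diagonal i j) s} h in
        T-meet⁺ ij (⊩-cylinder⁺ {m = s i} (diagonal i j ∩ᴿ ρ 0)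
          (⊩-resp (diagonal i j ∩ᴿ ρ 0) (λ k → ~-sym (update-self s ~-refl k)) h)))

    setAlgebra-locallyFinite : LocallyFinite setAlgebra
    setAlgebra-locallyFinite X = support X , λ i i∉ s → T-ext
      (λ h → case ⊩-cylinder⁻ X h of λ (m , h′) → ≡.subst T (depends X (unaffected i∉)) h′)
      (λ h → ⊩-cylinder⁺ {m = s i} X (⊩-resp X (λ k → ~-sym (update-self s ~-refl k)) h))
      where
      unaffected : ∀ {s i m} → i ∉ support X → ∀ k → k ∈ support X → (s ⟨ i ≔ m ⟩) k ~ s k
      unaffected {s} i∉ k k∈ = ~-reflexive (update-other s (λ { ≡.refl → i∉ k∈ }))

    -- The valuation `s′` supplies the witnesses of all the quantified coordinates at once.
    ⊩-cylinders : ∀ ks t {ρ s s′} → (∀ i → i ∉ map fin ks → s i ≡ s′ i) → s′ ⊩ ⟦_⟧ setAlgebra t ρ →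
                  s ⊩ ⟦_⟧ setAlgebra (foldr (λ k → c (fin k)) t ks) ρ
    ⊩-cylinders []       t {ρ} s≡s′ h =
      ⊩-resp-≡ (⟦_⟧ setAlgebra t ρ) (λ i → ≡.sym (s≡s′ i (λ ()))) h
    ⊩-cylinders (k ∷ ks) t {ρ} {s} {s′} s≡s′ h =
      ⊩-cylinder⁺ {m = s′ (fin k)} (⟦_⟧ setAlgebra (foldr (λ k → c (fin k)) t ks) ρ) (⊩-cylinders ks t off h)
      where
      off : ∀ i → i ∉ map fin ks → (s ⟨ fin k ≔ s′ (fin k) ⟩) i ≡ s′ i
      off i i∉ with i ≟ fin k
      ... | yes ≡.refl = ≡.refl
      ... | no  i≢k    = s≡s′ i λ { (here i≡k) → i≢k i≡k ; (there i∈) → i∉ i∈ }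

    ⊩-∏ : ∀ {ts ρ s} → All (λ t → s ⊩ ⟦_⟧ setAlgebra t ρ) ts → s ⊩ ⟦_⟧ setAlgebra (∏ ts) ρ
    ⊩-∏ {s = s} []       = ⊩-unit s
    ⊩-∏         (h ∷ hs) = T-meet⁺ h (⊩-∏ hs)

    -- The witness puts the pairwise distinct points `point n` at the coordinates `fin n` below
    -- `fin m`.
    setAlgebra-infiniteBase : InfiniteBase setAlgebra
    setAlgebra-infiniteBase m ρ s = T-ext (λ _ → ⊩-unit s) (λ _ →
      ⊩-cylinders (upTo m) _ {ρ} off (⊩-∏ {ρ = ρ} (concat⁺ (map⁺ (All.tabulate λ {j} j∈ →
        map⁺ (All.tabulate λ {i} i∈ → distinct i∈ j∈))))))
      where
      InRange : Index → Set ℓ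
      InRange i = ∃[ n ] (n ∈ upTo m × i ≡ fin n)
      assign : ∀ i → Dec (InRange i) → Point
      assign i (yes (n , _)) = point n
      assign i (no _)        = s i
      s′ : Valuation
      s′ i = assign i em
      off : ∀ i → i ∉ map fin (upTo m) → s i ≡ s′ i
      off i i∉ with em {P = InRange i}
      ... | yes (n , n∈ , ≡.refl) = contradiction (∈-map⁺ fin n∈) i∉
      ... | no  _                 = ≡.refl
      value : ∀ n → n ∈ upTo m → s′ (fin n) ≡ point n
      value n n∈ with em {P = InRange (fin n)}
      ... | yes (n′ , _ , eq) = ≡.cong point (≡.sym (fin-injective eq))
      ... | no  ¬in           = contradiction (n , n∈ , ≡.refl) ¬in
      distinct : ∀ {i j} → i ∈ upTo j → j ∈ upTo m → s′ ⊩ complement (diagonal (fin i) (fin j))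
      distinct {i} {j} i∈ j∈ = T-not⁺ λ h → ℕ.<-irrefl
        (point-injective (≡.subst₂ _~_ (value i (∈-upTo⁺ (ℕ.<-trans i<j (∈-upTo⁻ j∈)))) (value j j∈)
          (⊩-diagonal⁻ s′ (fin i) (fin j) h)))
        i<j
        where
        i<j : i ℕ.< j
        i<j = ∈-upTo⁻ i∈

    setAlgebra-∞Lf : ∞Lf setAlgebra
    setAlgebra-∞Lf = setAlgebra-CA , setAlgebra-locallyFinite , setAlgebra-infiniteBase

    -- The first-order meaning of the separating equations.

    module _ (ρ : ℕ → Relation) (s : Valuation) where

      triple : Point → Point → Point → Valuation
      triple a b m = s ⟨ fin 0 ≔ a ⟩ ⟨ fin 1 ≔ b ⟩ ⟨ fin 2 ≔ m ⟩

      Edge : Point → Point → Set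
      Edge a b = ∃[ m ] (triple a b m ⊩ ρ 0)

      Outer : Index → Set ℓ
      Outer k = k ≢ fin 0 × k ≢ fin 1 × k ≢ fin 2

      -- Following a path overwrites the coordinates 0, 1, 2 repeatedly; the parameters, on which
      -- `Edge` depends, stay those of `s`.
      Agrees : Valuation → Set ℓ
      Agrees s′ = ∀ k → Outer k → s′ k ≡ s k

      agrees-update : ∀ {s′ i m} → (∀ {k} → Outer k → k ≢ i) → Agrees s′ → Agrees (s′ ⟨ i ≔ m ⟩)
      agrees-update {s′} outer agr k out = ≡.trans (update-other s′ (outer out)) (agr k out)

      agrees₀ : ∀ {s′ m} → Agrees s′ → Agrees (s′ ⟨ fin 0 ≔ m ⟩)
      agrees₀ = agrees-update proj₁

      agrees₁ : ∀ {s′ m} → Agrees s′ → Agrees (s′ ⟨ fin 1 ≔ m ⟩)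
      agrees₁ = agrees-update (proj₁ ∘ proj₂)

      agrees₂ : ∀ {s′ m} → Agrees s′ → Agrees (s′ ⟨ fin 2 ≔ m ⟩)
      agrees₂ = agrees-update (proj₂ ∘ proj₂)

      triple-unique : ∀ {s′ a b m} → Agrees s′ →
        s′ (fin 0) ~ a → s′ (fin 1) ~ b → s′ (fin 2) ~ m → ∀ k → s′ k ~ triple a b m k
      triple-unique agr a~ b~ m~ k with k ≟ fin 2
      ... | yes ≡.refl = m~
      ... | no  k≢2 with k ≟ fin 1
      ...   | yes ≡.refl = b~
      ...   | no  k≢1 with k ≟ fin 0
      ...     | yes ≡.refl = a~
      ...     | no  k≢0    = ~-reflexive (agr k (k≢0 , k≢1 , k≢2))

      0≢1 : fin 0 ≢ fin 1
      0≢1 eq with () ← fin-injective eq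

      0≢2 : fin 0 ≢ fin 2
      0≢2 eq with () ← fin-injective eq

      1≢2 : fin 1 ≢ fin 2
      1≢2 eq with () ← fin-injective eq

      triple₀ : ∀ {a b m} → triple a b m (fin 0) ≡ a
      triple₀ = ≡.trans (update-other _ 0≢2) (≡.trans (update-other _ 0≢1) (update-same s (fin 0)))

      triple₁ : ∀ {a b m} → triple a b m (fin 1) ≡ b
      triple₁ {a} = ≡.trans (update-other _ 1≢2) (update-same (s ⟨ fin 0 ≔ a ⟩) (fin 1))

      agrees-triple : ∀ {a b m} → Agrees (triple a b m)
      agrees-triple = agrees₂ (agrees₁ (agrees₀ (λ _ _ → ≡.refl)))

      Edge-resp : ∀ {a a′ b b′} → a ~ a′ → b ~ b′ → Edge a b → Edge a′ b′
      Edge-resp {a} {b = b} a~ b~ (m , h) = m , ⊩-resp (ρ 0)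
        (triple-unique agrees-triple (~-trans (~-reflexive triple₀) a~)
          (~-trans (~-reflexive triple₁) b~)
          (~-reflexive (update-same (s ⟨ fin 0 ≔ a ⟩ ⟨ fin 1 ≔ b ⟩) (fin 2)))) h

      Path-resp : ∀ k {a a′ b b′} → a ~ a′ → b ~ b′ → Path _~_ Edge k a b → Path _~_ Edge k a′ b′
      Path-resp 0       a~ b~ a~b           = ~-trans (~-sym a~) (~-trans a~b b~)
      Path-resp (suc k) a~ b~ (m , e , p)   = m , Edge-resp a~ ~-refl e , Path-resp k ~-refl b~ p

      extend : ∀ {s′ a b m} → Agrees s′ → s′ (fin 0) ~ a → s′ (fin 1) ~ b →
               ∀ k → (s′ ⟨ fin 2 ≔ m ⟩) k ~ triple a b m k
      extend {s′} agr a~ b~ = triple-unique (agrees₂ agr)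
        (~-trans (~-reflexive (update-other s′ 0≢2)) a~)
        (~-trans (~-reflexive (update-other s′ 1≢2)) b~)
        (~-reflexive (update-same s′ (fin 2)))

      infix 4 _⊨ᵗ_
      _⊨ᵗ_ : Valuation → Term α → Set
      s′ ⊨ᵗ t = s′ ⊩ ⟦_⟧ setAlgebra t ρ

      ⊩-edge⁺ : ∀ {s′ a b} → Agrees s′ → s′ (fin 0) ~ a → s′ (fin 1) ~ b → Edge a b → s′ ⊨ᵗ edge
      ⊩-edge⁺ agr a~ b~ (m , h) =
        ⊩-cylinder⁺ {m = m} (ρ 0) (⊩-resp (ρ 0) (~-sym ∘ extend agr a~ b~) h)

      ⊩-edge⁻ : ∀ {s′ a b} → Agrees s′ → s′ (fin 0) ~ a → s′ (fin 1) ~ b → s′ ⊨ᵗ edge → Edge a b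
      ⊩-edge⁻ agr a~ b~ h with m , h′ ← ⊩-cylinder⁻ (ρ 0) h = m , ⊩-resp (ρ 0) (extend agr a~ b~) h′

      private
        ⟦diag⟧ ⟦hop⟧ ⟦step⟧ : ℕ → Relation
        ⟦hop⟧ k  = ⟦_⟧ setAlgebra (d (fin 0) (fin 1) · path k) ρ
        ⟦step⟧ k = ⟦_⟧ setAlgebra (edge · c (fin 0) (d (fin 0) (fin 1) · path k)) ρ
        ⟦diag⟧ k = ⟦_⟧ setAlgebra (path k · - d (fin 0) (fin 2)) ρ

      -- After each edge, `c (fin 0) (d (fin 0) (fin 1) · _)` moves the vertex reached from
      -- coordinate 1 to coordinate 0, so three coordinates serve paths of any length.
      ⊩-path⁺ : ∀ k {s′ a b} → Agrees s′ → s′ (fin 0) ~ a → s′ (fin 2) ~ b →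
                Path _~_ Edge k a b → s′ ⊨ᵗ path k
      ⊩-path⁺ 0 {s′} agr a~ b~ a~b =
        ⊩-diagonal⁺ s′ (fin 0) (fin 2) (~-trans a~ (~-trans a~b (~-sym b~)))
      ⊩-path⁺ (suc k) {s′} agr a~ b~ (m , e , p) = ⊩-cylinder⁺ {m = m} (⟦step⟧ k) (T-meet⁺
        (⊩-edge⁺ (agrees₁ agr) (~-trans (~-reflexive (update-other s′ 0≢1)) a~)
          (~-reflexive (update-same s′ (fin 1))) e)
        (⊩-cylinder⁺ {m = m} (⟦hop⟧ k) (T-meet⁺
          (⊩-diagonal⁺ s″ (fin 0) (fin 1) (~-reflexive (≡.trans (update-same s₁ (fin 0))
            (≡.sym (≡.trans (update-other s₁ (0≢1 ∘ ≡.sym)) (update-same s′ (fin 1)))))))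
          (⊩-path⁺ k (agrees₀ (agrees₁ agr)) (~-reflexive (update-same s₁ (fin 0)))
            (~-trans (~-reflexive (≡.trans (update-other s₁ (0≢2 ∘ ≡.sym))
              (update-other s′ (1≢2 ∘ ≡.sym)))) b~) p))))
        where
        s₁ s″ : Valuation
        s₁ = s′ ⟨ fin 1 ≔ m ⟩
        s″ = s₁ ⟨ fin 0 ≔ m ⟩

      ⊩-path⁻ : ∀ k {s′ a b} → Agrees s′ → s′ (fin 0) ~ a → s′ (fin 2) ~ b →
                s′ ⊨ᵗ path k → Path _~_ Edge k a b
      ⊩-path⁻ 0 {s′} agr a~ b~ h =
        ~-trans (~-sym a~) (~-trans (⊩-diagonal⁻ s′ (fin 0) (fin 2) h) b~)
      ⊩-path⁻ (suc k) {s′} agr a~ b~ h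
        with m , h₁ ← ⊩-cylinder⁻ (⟦step⟧ k) h
        with e , h₂ ← T-meet⁻ {holds (⟦_⟧ setAlgebra edge ρ) (s′ ⟨ fin 1 ≔ m ⟩)} h₁
        with n , h₃ ← ⊩-cylinder⁻ (⟦hop⟧ k) h₂
        with δ , p ← T-meet⁻ {holds (diagonal (fin 0) (fin 1)) (s′ ⟨ fin 1 ≔ m ⟩ ⟨ fin 0 ≔ n ⟩)} h₃ =
        m , ⊩-edge⁻ (agrees₁ agr) (~-trans (~-reflexive (update-other s′ 0≢1)) a~)
              (~-reflexive (update-same s′ (fin 1))) e
          , ⊩-path⁻ k (agrees₀ (agrees₁ agr))
              (~-trans (⊩-diagonal⁻ (s₁ ⟨ fin 0 ≔ n ⟩) (fin 0) (fin 1) δ)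
                (~-reflexive (≡.trans (update-other s₁ (0≢1 ∘ ≡.sym)) (update-same s′ (fin 1)))))
              (~-trans (~-reflexive (≡.trans (update-other s₁ (0≢2 ∘ ≡.sym))
                (update-other s′ (1≢2 ∘ ≡.sym)))) b~) p
        where
        s₁ : Valuation
        s₁ = s′ ⟨ fin 1 ≔ m ⟩

      agrees-refl : Agrees s
      agrees-refl _ _ = ≡.refl

      private
        at₀ : ∀ {a} → (s ⟨ fin 0 ≔ a ⟩) (fin 0) ~ a
        at₀ = ~-reflexive (update-same s (fin 0))

        at₀₁ : ∀ {a b} → (s ⟨ fin 0 ≔ a ⟩ ⟨ fin 1 ≔ b ⟩) (fin 0) ~ a
        at₀₁ {a} = ~-trans (~-reflexive (update-other (s ⟨ fin 0 ≔ a ⟩) 0≢1)) at₀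

        at₁ : ∀ {a b} → (s ⟨ fin 0 ≔ a ⟩ ⟨ fin 1 ≔ b ⟩) (fin 1) ~ b
        at₁ {a} = ~-reflexive (update-same (s ⟨ fin 0 ≔ a ⟩) (fin 1))

        at₀₂ : ∀ {a b} → (s ⟨ fin 0 ≔ a ⟩ ⟨ fin 2 ≔ b ⟩) (fin 0) ~ a
        at₀₂ {a} = ~-trans (~-reflexive (update-other (s ⟨ fin 0 ≔ a ⟩) 0≢2)) at₀

        at₂ : ∀ {a b} → (s ⟨ fin 0 ≔ a ⟩ ⟨ fin 2 ≔ b ⟩) (fin 2) ~ b
        at₂ {a} = ~-reflexive (update-same (s ⟨ fin 0 ≔ a ⟩) (fin 2))

        ⟦edge⟧ ⟦loop⟧ : Relation
        ⟦edge⟧ = ⟦_⟧ setAlgebra edge ρ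
        ⟦loop⟧ = ⟦_⟧ setAlgebra (d (fin 0) (fin 1) · edge) ρ

      ⊩-serial⁺ : (∀ a → ∃[ b ] Edge a b) → s ⊨ᵗ serial
      ⊩-serial⁺ ser = T-not⁺ λ h →
        let (a , h′) = ⊩-cylinder⁻ (complement (cylinder (fin 1) ⟦edge⟧)) h
            (b , e)  = ser a
        in T-not⁻ h′ (⊩-cylinder⁺ {m = b} ⟦edge⟧ (⊩-edge⁺ (agrees₁ (agrees₀ agrees-refl)) at₀₁ at₁ e))

      ⊩-serial⁻ : s ⊨ᵗ serial → ∀ a → ∃[ b ] Edge a b
      ⊩-serial⁻ h a =
        let (b , e) = ⊩-cylinder⁻ ⟦edge⟧ (T-stable (T-not⁻ h ∘
                        ⊩-cylinder⁺ {m = a} (complement (cylinder (fin 1) ⟦edge⟧))))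
        in b , ⊩-edge⁻ (agrees₁ (agrees₀ agrees-refl)) at₀₁ at₁ e

      ⊩-irreflexive⁺ : (∀ {a b} → Edge a b → ¬ a ~ b) → s ⊨ᵗ irreflexive
      ⊩-irreflexive⁺ irr = T-not⁺ λ h →
        let (a , h₁) = ⊩-cylinder⁻ (cylinder (fin 1) ⟦loop⟧) h
            (b , h₂) = ⊩-cylinder⁻ ⟦loop⟧ h₁
            s′       = s ⟨ fin 0 ≔ a ⟩ ⟨ fin 1 ≔ b ⟩
            (δ , e)  = T-meet⁻ {holds (diagonal (fin 0) (fin 1)) s′} h₂
        in irr (⊩-edge⁻ (agrees₁ (agrees₀ agrees-refl)) at₀₁ at₁ e)
               (~-trans (~-sym at₀₁) (~-trans (⊩-diagonal⁻ s′ (fin 0) (fin 1) δ) at₁))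

      ⊩-irreflexive⁻ : s ⊨ᵗ irreflexive → ∀ {a b} → Edge a b → ¬ a ~ b
      ⊩-irreflexive⁻ h {a} {b} e a~b = T-not⁻ h
        (⊩-cylinder⁺ {m = a} (cylinder (fin 1) ⟦loop⟧) (⊩-cylinder⁺ {m = b} ⟦loop⟧ (T-meet⁺
          (⊩-diagonal⁺ (s ⟨ fin 0 ≔ a ⟩ ⟨ fin 1 ≔ b ⟩) (fin 0) (fin 1)
            (~-trans at₀₁ (~-trans a~b (~-sym at₁))))
          (⊩-edge⁺ (agrees₁ (agrees₀ agrees-refl)) at₀₁ at₁ e))))

      ⊩-periodic⁺ : ∀ p → (∀ {a b} → Path _~_ Edge p a b → a ~ b) → s ⊨ᵗ periodic p
      ⊩-periodic⁺ p per = T-not⁺ λ h →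
        let (a , h₁) = ⊩-cylinder⁻ (cylinder (fin 2) (⟦diag⟧ p)) h
            (b , h₂) = ⊩-cylinder⁻ (⟦diag⟧ p) h₁
            s′       = s ⟨ fin 0 ≔ a ⟩ ⟨ fin 2 ≔ b ⟩
            (π , ¬δ) = T-meet⁻ {holds (⟦_⟧ setAlgebra (path p) ρ) s′} h₂
            a~b      = per (⊩-path⁻ p (agrees₂ (agrees₀ agrees-refl)) at₀₂ at₂ π)
        in T-not⁻ ¬δ (⊩-diagonal⁺ s′ (fin 0) (fin 2) (~-trans at₀₂ (~-trans a~b (~-sym at₂))))

      ⊩-periodic⁻ : ∀ p → s ⊨ᵗ periodic p → ∀ {a b} → Path _~_ Edge p a b → a ~ b
      ⊩-periodic⁻ p h {a} {b} π = ~-trans (~-sym at₀₂) (~-trans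
        (⊩-diagonal⁻ s′ (fin 0) (fin 2) (T-stable λ ¬δ → T-not⁻ h
          (⊩-cylinder⁺ {m = a} (cylinder (fin 2) (⟦diag⟧ p)) (⊩-cylinder⁺ {m = b} (⟦diag⟧ p) (T-meet⁺
            (⊩-path⁺ p (agrees₂ (agrees₀ agrees-refl)) at₀₂ at₂ π) ¬δ)))))
        at₂)
        where
        s′ : Valuation
        s′ = s ⟨ fin 0 ≔ a ⟩ ⟨ fin 2 ≔ b ⟩

      ⊩-rotation⁺ : ∀ {p} → IsRotation _~_ Edge p → s ⊨ᵗ serial · (irreflexive · periodic p)
      ⊩-rotation⁺ {p} rot = T-meet⁺ (⊩-serial⁺ isSerial)
        (T-meet⁺ (⊩-irreflexive⁺ isIrreflexive) (⊩-periodic⁺ p isPeriodic))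
        where open IsRotation rot

      ⊩-rotation⁻ : ∀ {p} → s ⊨ᵗ serial · (irreflexive · periodic p) → IsRotation _~_ Edge p
      ⊩-rotation⁻ {p} h =
        let (h₁ , h′) = T-meet⁻ {holds (⟦_⟧ setAlgebra serial ρ) s} h
            (h₂ , h₃) = T-meet⁻ {holds (⟦_⟧ setAlgebra irreflexive ρ) s} h′
        in record
          { isSerial      = ⊩-serial⁻ h₁
          ; isIrreflexive = ⊩-irreflexive⁻ h₂
          ; isPeriodic    = ⊩-periodic⁻ p h₃
          }

    noRotation⁺ : ∀ {p} → (∀ ρ s → ¬ IsRotation _~_ (Edge ρ s) p) → setAlgebra ⊨ noRotation p
    noRotation⁺ ¬rot ρ s = T-ext
      (λ h → contradiction (⊩-rotation⁻ ρ s h) (¬rot ρ s))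
      (λ h → contradiction (⊩-unit s) (T-not⁻ h))

    noRotation⁻ : ∀ {p} → setAlgebra ⊨ noRotation p → ∀ ρ s → ¬ IsRotation _~_ (Edge ρ s) p
    noRotation⁻ sat ρ s rot = T-not⁻ (≡.subst T (sat ρ s) (⊩-rotation⁺ ρ s rot)) (⊩-unit s)

  -- Rotations in the algebras of cycles.

  module CyclicAlgebra (em : ∀ {a : Level} → ExcludedMiddle a) (q-1 : ℕ) where

    private
      q : ℕ
      q = suc q-1

    open Base (cyclic q-1)
    open SetAlgebra em (cyclic q-1)

    fresh-cycle : ∀ (s : Valuation) is → ∃[ b ] (∀ i → i ∈ is → proj₁ (s i) ℕ.< b)
    fresh-cycle s []       = 0 , λ _ ()
    fresh-cycle s (i ∷ is) with b , below ← fresh-cycle s is = suc (proj₁ (s i)) ⊔ b , λ where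
      _ (here ≡.refl) → ℕ.m≤m⊔n _ b
      j (there j∈)    → ℕ.≤-trans (below j j∈) (ℕ.m≤n⊔m (suc (proj₁ (s i))) b)

    -- Only cycle `b` turns, so parameters on other cycles are fixed.
    rotate : ℕ → ℕ → Symmetry
    rotate b k b′ with b′ ℕ.≟ b
    ... | yes _ = k
    ... | no  _ = 0

    rotate-same : ∀ b k → rotate b k b ≡ k
    rotate-same b k with b ℕ.≟ b
    ... | yes _   = ≡.refl
    ... | no  b≢b = contradiction ≡.refl b≢b

    rotate-other : ∀ {b k b′} → b′ ≢ b → rotate b k b′ ≡ 0
    rotate-other {b} {k} {b′} b′≢b with b′ ℕ.≟ b
    ... | yes b′≡b = contradiction b′≡b b′≢b
    ... | no  _    = ≡.refl

    act-rotate : ∀ b v k → act (rotate b k) (b , v) ~ (b , v ℕ.+ k)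
    act-rotate b v k = ≡.refl , ≡.cong (λ r → (v ℕ.+ r) % q) (rotate-same b k)

    rotate-fixes : ∀ {b b′ v k} → b′ ≢ b → act (rotate b k) (b′ , v) ~ (b′ , v)
    rotate-fixes {v = v} b′≢b = ≡.refl ,
      ≡.cong (_% q) (≡.trans (≡.cong (v ℕ.+_) (rotate-other b′≢b)) (ℕ.+-identityʳ v))

    0%q≢1%q : 1 ℕ.< q → 0 % q ≢ 1 % q
    0%q≢1%q 1<q eq with () ← ≡.trans eq (m<n⇒m%n≡m 1<q)

    module _ (1<q : 1 ℕ.< q) (p-1 : ℕ) (coprime : Coprime q (suc p-1))
             (ρ : ℕ → Relation) (s : Valuation) where

      private
        p : ℕ
        p = suc p-1

      -- The relation R defined by ρ 0 takes its parameters from s, hence is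
      -- invariant under rotation of a cycle b that s avoids.  If R leads from
      -- b to another cycle, two points of b have a common successor and so,
      -- by periodicity, are equal; otherwise R advances along b by a constant
      -- v with q ∣ p v, so q ∣ v, against irreflexivity.
      ¬rotation : ¬ IsRotation _~_ (Edge ρ s) p
      ¬rotation rot = go (isSerial (b , 0))
        where
        open IsRotation rot
        open Relation (ρ 0)
        b : ℕ
        b = proj₁ (fresh-cycle s support)
        avoids : ∀ i → i ∈ support → proj₁ (s i) ≢ b
        avoids i i∈ eq = ℕ.<-irrefl eq (proj₂ (fresh-cycle s support) i i∈)
        act-triple : ∀ g {x y m} → (∀ i → i ∈ support → act g (s i) ~ s i) →
          ∀ i → i ∈ support → act g (triple ρ s x y m i) ~ triple ρ s (act g x) (act g y) (act g m) i
        act-triple g fixes i i∈ with i ≟ fin 2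
        ... | yes _ = ~-refl
        ... | no  _ with i ≟ fin 1
        ...   | yes _ = ~-refl
        ...   | no  _ with i ≟ fin 0
        ...     | yes _ = ~-refl
        ...     | no  _ = fixes i i∈
        shift : ∀ k {x y} → Edge ρ s x y → Edge ρ s (act (rotate b k) x) (act (rotate b k) y)
        shift k {x} {y} (m , h) = act (rotate b k) m ,
          ≡.subst T (depends (act-triple (rotate b k) λ i i∈ → rotate-fixes (avoids i i∈)))
            (≡.subst T (≡.sym (invariant (rotate b k) (triple ρ s x y m))) h)
        run : ∀ k x → ∃[ y ] Path _~_ (Edge ρ s) k x y
        run 0       x = x , ~-refl
        run (suc k) x =
          let (y , e) = isSerial x
              (z , π) = run k y
          in z , y , e , π
        go : ¬ (∃[ y ] Edge ρ s (b , 0) y)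
        go ((b′ , v) , e) with b′ ℕ.≟ b
        ... | no b′≢b =
          -- Turning cycle `b` by one moves the source of `e` but not its target; the same
          -- continuation `π` completes both edges to paths of length `p`.
          let (z , π) = run p-1 (b′ , v)
              e₁      = Edge-resp ρ s (act-rotate b 0 1) (rotate-fixes b′≢b) (shift 1 e)
              b0~b1   = ~-trans (isPeriodic (_ , e , π)) (~-sym (isPeriodic (_ , e₁ , π)))
          in 0%q≢1%q 1<q (position b0~b1)
        ... | yes ≡.refl = isIrreflexive e
          (≡.refl , ≡.sym (n∣m⇒m%n≡0 v q (coprime-divisor coprime
            (m%n≡0⇒n∣m (p ℕ.* v) q (≡.trans (≡.cong (_% q) (≡.sym (ℕ.+-identityʳ (p ℕ.* v))))
              (≡.sym (position (isPeriodic (advance p 0)))))))))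
          where
          step : ∀ j → Edge ρ s (b , j) (b , v ℕ.+ j)
          step j = Edge-resp ρ s (act-rotate b 0 j) (act-rotate b v j) (shift j e)
          advance : ∀ k j → Path _~_ (Edge ρ s) k (b , j) (b , k ℕ.* v ℕ.+ j)
          advance 0       j = ~-refl
          advance (suc k) j = _ , step j , Path-resp ρ s k ~-refl
            (~-reflexive (≡.cong (b ,_) (≡.trans (≡.sym (ℕ.+-assoc (k ℕ.* v) v j))
              (≡.cong (ℕ._+ j) (ℕ.+-comm (k ℕ.* v) v)))))
            (advance k (v ℕ.+ j))


    successor : Point → Point
    successor (b , v) = b , suc v

    successor-cong : ∀ {x y} → x ~ y → successor x ~ successor y
    successor-cong {_ , v} {_ , v′} (b≡b′ , r) = b≡b′ , ≡.subst₂ (λ m n → m % q ≡ n % q)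
      (ℕ.+-comm v 1) (ℕ.+-comm v′ 1) (%-cong-+ʳ v v′ q 1 r)

    successorRelation : Relation
    successorRelation = record
      { holds     = λ s → isYes (em {P = s (fin 1) ~ successor (s (fin 0))})
      ; support   = fin 0 ∷ fin 1 ∷ []
      ; depends   = λ s~s′ →
          let s₀ = s~s′ (fin 0) (here ≡.refl) ; s₁ = s~s′ (fin 1) (there (here ≡.refl)) in
          isYes-⇔ em em (mk⇔
            (λ h → ~-trans (~-sym s₁) (~-trans h (successor-cong s₀)))
            (λ h → ~-trans s₁ (~-trans h (successor-cong (~-sym s₀)))))
      -- `successor` commutes with every `act g` by computation.
      ; invariant = λ g s → isYes-⇔ em em (mk⇔ (act-reflects g) (act-cong g))
      }

    module _ (1<q : 1 ℕ.< q) (s : Valuation) where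

      private
        R : Point → Point → Set
        R = Edge (λ _ → successorRelation) s

      edge⁺ : ∀ {x} → R x (successor x)
      edge⁺ {x} = x , fromWitness (~-reflexive (≡.trans (triple₁ (λ _ → successorRelation) s)
        (≡.sym (≡.cong successor (triple₀ (λ _ → successorRelation) s)))))

      edge⁻ : ∀ {x y} → R x y → y ~ successor x
      edge⁻ (m , h) = ≡.subst₂ (λ x y → y ~ successor x)
        (triple₀ (λ _ → successorRelation) s) (triple₁ (λ _ → successorRelation) s) (toWitness h)

      path⁻ : ∀ k {x y} → Path _~_ R k x y → y ~ (proj₁ x , proj₂ x ℕ.+ k)
      path⁻ 0       {b , v} x~y = ~-trans (~-sym x~y)
        (~-reflexive (≡.cong (b ,_) (≡.sym (ℕ.+-identityʳ v))))
      path⁻ (suc k) {b , v} ((b′ , w) , e , π) = ~-trans (path⁻ k π) (shifted (edge⁻ e))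
        where
        shifted : (b′ , w) ~ (b , suc v) → (b′ , w ℕ.+ k) ~ (b , v ℕ.+ suc k)
        shifted (b′≡b , r) = b′≡b , ≡.trans (%-cong-+ʳ w (suc v) q k r)
          (≡.cong (_% q) (≡.sym (ℕ.+-suc v k)))

      successor-rotation : IsRotation _~_ R q
      successor-rotation = record
        { isSerial      = λ x → successor x , edge⁺
        ; isIrreflexive = λ {(b , v)} {(b′ , w)} e x~y → 0%q≢1%q 1<q
            (%-cancel-+ʳ 0 1 q-1 v (position (~-trans x~y (edge⁻ e))))
        ; isPeriodic    = λ {(b , v)} π → ~-sym (~-trans (path⁻ q π)
            (≡.refl , ≡.trans (≡.cong (λ k → (v ℕ.+ k) % q) (≡.sym (ℕ.+-identityʳ q)))
                              ([m+kn]%n≡m%n v 1 q)))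
        }

    noRotation-coprime : 1 ℕ.< q → ∀ p → Coprime q (suc p) → setAlgebra ⊨ noRotation (suc p)
    noRotation-coprime 1<q p coprime = noRotation⁺ (¬rotation 1<q p coprime)

    noRotation-fails : 1 ℕ.< q → ¬ (setAlgebra ⊨ noRotation q)
    noRotation-fails 1<q sat =
      noRotation⁻ sat (λ _ → successorRelation) (λ _ → point 0) (successor-rotation 1<q _)

  -- Continuum many varieties.

  module _ (em : ∀ {a : Level} → ExcludedMiddle a) where

    -- `cyclic` takes the cycle length minus one, so these cycles have length `sylvester n`.
    sylvesterAlgebra : ℕ → Algebra α
    sylvesterAlgebra n = SetAlgebra.setAlgebra em (cyclic (sylvesterProduct n))

    sylvesterClass : (ℕ → Bool) → Class {α = α}
    sylvesterClass β A = ∃[ n ] (β n ≡ true × A ≡ sylvesterAlgebra n)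

    sylvesterClass-∞Lf : ∀ β → sylvesterClass β ⊆ ∞Lf
    sylvesterClass-∞Lf β (n , _ , ≡.refl) = SetAlgebra.setAlgebra-∞Lf em (cyclic (sylvesterProduct n))

    sylvesterClass-mono : ∀ {β γ} → (∀ n → β n ≡ γ n) → sylvesterClass β ⊆ sylvesterClass γ
    sylvesterClass-mono β≡γ (n , βn , eq) = n , ≡.trans (≡.sym (β≡γ n)) βn , eq

    noRotation-valid : ∀ {β n} → β n ≡ false → Th (sylvesterClass β) (noRotation (sylvester n))
    noRotation-valid {n = n} βn (m , βm , ≡.refl) =
      CyclicAlgebra.noRotation-coprime em (sylvesterProduct m) (1<sylvester m) (sylvesterProduct n)
        (sylvester-coprime {m} {n} λ { ≡.refl → case ≡.trans (≡.sym βm) βn of λ () })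

    -- If `γ n` were false, `noRotation (sylvester n)` would hold in the variety of `γ`, yet
    -- `sylvesterAlgebra n` refutes it and lies in the variety of `β`.
    sylvesterClass-reflects : ∀ {β γ} → Mod (Th (sylvesterClass β)) ⊆ Mod (Th (sylvesterClass γ)) →
                              ∀ n → β n ≡ true → γ n ≡ true
    sylvesterClass-reflects {β} {γ} β⊆γ n βn with γ n in γn
    ... | true  = ≡.refl
    ... | false = contradiction
      (β⊆γ {sylvesterAlgebra n} (λ {e} sat → sat {sylvesterAlgebra n} (n , βn , ≡.refl))
        {noRotation (sylvester n)} (λ {A} → noRotation-valid {γ} γn {A}))
      (CyclicAlgebra.noRotation-fails em (sylvesterProduct n) (1<sylvester n))

    reals↣LfGenerated : Injection (ℕ →-setoid Bool) (LfGeneratedVarieties α)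
    reals↣LfGenerated = record
      { to        = λ β → Mod (Th (sylvesterClass β)) , sylvesterClass β ,
                          (λ {A} → sylvesterClass-∞Lf β {A}) , Mod-Th-generated (sylvesterClass β)
      ; cong      = λ {β} {γ} β≡γ →
          (λ {A} → mono β γ β≡γ {A}) , (λ {A} → mono γ β (≡.sym ∘ β≡γ) {A})
      ; injective = λ {β} {γ} (β⊆γ , γ⊆β) n → ⇔→≡ {z = true} (mk⇔
          (sylvesterClass-reflects (λ {A} → β⊆γ {A}) n)
          (sylvesterClass-reflects (λ {A} → γ⊆β {A}) n))
      }
      where
      mono : ∀ β γ → (∀ n → β n ≡ γ n) → Mod (Th (sylvesterClass β)) ⊆ Mod (Th (sylvesterClass γ))
      mono β γ β≡γ {A} sat {e} Ke = sat {e}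
        (Th-antitone {sylvesterClass β} {sylvesterClass γ}
          (λ {A} → sylvesterClass-mono {β} {γ} β≡γ {A}) e Ke)

    LfGenerated↣inductive : Injection (LfGeneratedVarieties α) (InductiveVarietiesOfInfiniteBase α)
    LfGenerated↣inductive = record
      { to        = λ (V , K , K⊆ , gen) → V , generated-inductive em (λ {A} → K⊆ {A}) gen
      ; cong      = λ (V⊆W , W⊆V) → (λ {A} → V⊆W {A}) , (λ {A} → W⊆V {A})
      ; injective = λ (V⊆W , W⊆V) → (λ {A} → V⊆W {A}) , (λ {A} → W⊆V {A})
      }

theorem4p7 : (∀ {a : Level} → ExcludedMiddle a) →
    ∀ {ℓ : Level} (α : InfiniteOrdinal ℓ) →
    ContinuumMany (LfGeneratedVarieties α) ×
    ContinuumMany (InductiveVarietiesOfInfiniteBase α)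
theorem4p7 em α =
  -- The three injections form a cycle from the reals through the generated and the inductive
  -- varieties back to the reals; each bijection combines one of them with the composite of the
  -- other two.
  SchröderBernstein.bijection em
    (injection (LfGenerated↣inductive em) (inductive↣reals em)) (reals↣LfGenerated em) ,
  SchröderBernstein.bijection em
    (inductive↣reals em) (injection (reals↣LfGenerated em) (LfGenerated↣inductive em))
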